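{- Let $G$ be a finite simple graph such that $\chi(G)-\omega(G)\ge 3$ and $|V(G)|=\chi(G)+6$. Then either $\chi(G)\ge 7$ and $G$ is isomorphic to $K_{\chi(G)-7}+Q$, or $\chi(G)\ge 9$ and $G$ is isomorphic to $K_{\chi(G)-9}+C_5+C_5+C_5$.
   Context: All graphs are finite, undirected, without loops or multiple edges. $\chi(G)$ is the chromatic number and $\omega(G)$ the clique number (largest size of a set of pairwise adjacent vertices). $K_n$ is the complete graph on $n$ vertices ($K_0$ is the empty graph, so $K_0+H=H$), and $C_5$ is the 5-cycle. For graphs $G_1,G_2$, the join $G_1+G_2$ is the graph on the disjoint union $V(G_1)\cup V(G_2)$ whose edges are those of $G_1$, those of $G_2$, and all edges $xy$ with $x\in V(G_1)$, $y\in V(G_2)$; the join is associative. $Q$ is the 13-vertex graph with vertex set $\mathbb{Z}_{13}$ in which distinct $i,j$ are adjacent iff $i-j\notin\{\pm1,\pm5\}\pmod{13}$; i.e. the complement $\overline{Q}$ is the circulant graph on $\mathbb{Z}_{13}$ with connection set $\{\pm1,\pm5\}$. -}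

module Defs where

open import Data.Nat using (ℕ; _<_; _≤_; _+_)
open import Data.Fin using (Fin; toℕ; splitAt)
open import Data.Fin.Subset using (Subset; _∈_; ∣_∣)
open import Data.Bool using (Bool; true; false; not; _∧_; _∨_)
open import Data.Sum using (_⊎_; inj₁; inj₂)
open import Data.Product using (Σ; _×_; ∃)
open import Relation.Binary.PropositionalEquality using (_≡_; _≢_)
open import Relation.Nullary using (¬_; does)
open import Function.Bundles using (_↔_; Inverse)
open import Data.Fin using (_≟_)
open import Data.Nat.DivMod using (_%_)
open import Data.Nat as ℕ using ()

record Graph (n : ℕ) : Set where
  field
    adj   : Fin n → Fin n → Bool
    adj-sym : ∀ i j → adj i j ≡ adj j i
    adj-irrefl : ∀ i → adj i i ≡ false
open Graph public

IsColouring : ∀ {n} → Graph n → (k : ℕ) → (Fin n → Fin k) → Set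
IsColouring G k c = ∀ i j → adj G i j ≡ true → c i ≢ c j

Colourable : ∀ {n} → Graph n → ℕ → Set
Colourable {n} G k = Σ (Fin n → Fin k) (IsColouring G k)

IsChromaticNumber : ∀ {n} → Graph n → ℕ → Set
IsChromaticNumber G k = Colourable G k × (∀ m → m < k → ¬ Colourable G m)

IsClique : ∀ {n} → Graph n → Subset n → Set
IsClique G S = ∀ i j → i ∈ S → j ∈ S → i ≢ j → adj G i j ≡ true

IsCliqueNumber : ∀ {n} → Graph n → ℕ → Set
IsCliqueNumber {n} G w =
  (Σ (Subset n) λ S → IsClique G S × ∣ S ∣ ≡ w) ×
  (∀ S → IsClique G S → ∣ S ∣ ≤ w)

record _≅_ {n m : ℕ} (G : Graph n) (H : Graph m) : Set where
  field
    bij      : Fin n ↔ Fin m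
    preserve : ∀ i j → adj H (Inverse.to bij i) (Inverse.to bij j) ≡ adj G i j
open _≅_ public

K : (n : ℕ) → Graph n
K n = record
  { adj = λ i j → not (does (i ≟ j))
  ; adj-sym = symK
  ; adj-irrefl = irrK }
  where
  open import Relation.Binary.PropositionalEquality using (refl; sym)
  open import Relation.Nullary using (yes; no)
  symK : ∀ i j → not (does (i ≟ j)) ≡ not (does (j ≟ i))
  symK i j with i ≟ j | j ≟ i
  ... | yes _ | yes _ = refl
  ... | no _  | no _  = refl
  ... | yes p | no q  = Data.Empty.⊥-elim (q (sym p))
    where import Data.Empty
  ... | no p  | yes q = Data.Empty.⊥-elim (p (sym q))
    where import Data.Empty
  irrK : ∀ i → not (does (i ≟ i)) ≡ false
  irrK i with i ≟ i
  ... | yes _ = refl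
  ... | no q = Data.Empty.⊥-elim (q refl)
    where import Data.Empty

joinAdj : ∀ {a b} → Graph a → Graph b → Fin (a + b) → Fin (a + b) → Bool
joinAdj {a} G H i j with splitAt a i | splitAt a j
... | inj₁ x | inj₁ y = adj G x y
... | inj₂ x | inj₂ y = adj H x y
... | inj₁ _ | inj₂ _ = true
... | inj₂ _ | inj₁ _ = true

_⊕_ : ∀ {a b} → Graph a → Graph b → Graph (a + b)
_⊕_ {a} {b} G H = record { adj = joinAdj G H ; adj-sym = s ; adj-irrefl = r }
  where
  open import Relation.Binary.PropositionalEquality using (refl)
  s : ∀ i j → joinAdj G H i j ≡ joinAdj G H j i
  s i j with splitAt a i | splitAt a j
  ... | inj₁ x | inj₁ y = adj-sym G x y
  ... | inj₂ x | inj₂ y = adj-sym H x y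
  ... | inj₁ _ | inj₂ _ = refl
  ... | inj₂ _ | inj₁ _ = refl
  r : ∀ i → joinAdj G H i i ≡ false
  r i with splitAt a i
  ... | inj₁ x = adj-irrefl G x
  ... | inj₂ x = adj-irrefl H x
infixr 6 _⊕_

-- Circulant graph on ℤ_n (n ≥ 1) with connection set given by a Bool test
-- on the residue d = (i - j) mod n ∈ {0,…,n-1}.
diffMod : (n : ℕ) → Fin (ℕ.suc n) → Fin (ℕ.suc n) → ℕ
diffMod n i j = (toℕ i ℕ.+ (ℕ.suc n ℕ.∸ toℕ j)) % ℕ.suc n

isC5diff : ℕ → Bool
isC5diff 1 = true
isC5diff 4 = true
isC5diff _ = false

-- Q: i ~ j iff i ≠ j and i - j ∉ {±1, ±5} (mod 13); residues 0,1,12,5,8 excluded.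
isQdiff : ℕ → Bool
isQdiff 0 = false
isQdiff 1 = false
isQdiff 12 = false
isQdiff 5 = false
isQdiff 8 = false
isQdiff _ = true

C5adj : Fin 5 → Fin 5 → Bool
C5adj i j = isC5diff (diffMod 4 i j)

Qadj : Fin 13 → Fin 13 → Bool
Qadj i j = isQdiff (diffMod 12 i j)

module _ where
  open import Relation.Nullary.Decidable using (toWitness)
  open import Data.Fin.Properties using (all?)
  open import Data.Bool.Properties renaming (_≟_ to _≟ᵇ_)
  open import Relation.Binary.PropositionalEquality using (refl)

  C5 : Graph 5
  C5 = record
    { adj = C5adj
    ; adj-sym = toWitness {a? = all? λ i → all? λ j → C5adj i j ≟ᵇ C5adj j i} _
    ; adj-irrefl = toWitness {a? = all? λ i → C5adj i i ≟ᵇ false} _ }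

  Q : Graph 13
  Q = record
    { adj = Qadj
    ; adj-sym = toWitness {a? = all? λ i → all? λ j → Qadj i j ≟ᵇ Qadj j i} _
    ; adj-irrefl = toWitness {a? = all? λ i → Qadj i i ≟ᵇ false} _ }

{-# OPTIONS --safe #-}

-- Pass to the complement H of G: χ is the least number of cliques covering H and ω its independence number,
-- so H has gap χ - ω ≥ 3 although n - χ = 6 only. By induction on |W|, a vertex set W of H with gap ≥ g ≤ 3
-- is covered by fewer than |W| - 2g cliques, unless it is a disjoint union of isolated points, pentagons
-- (gap 1) and copies of the complement of Q (gap 3) with total gap g.
--
-- If deleting some vertex keeps the gap, use induction: the deleted vertex is isolated, or it is matched
-- into a piece, each of which has a perfect matching after the deletion of any vertex. If W contains a
-- triangle, deleting it lowers the gap by at most one, and the triangle can be absorbed into the pieces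
-- that remain. Otherwise W is triangle-free and every vertex is missed by a maximum matching. By Gallai's
-- lemma "no maximum matching misses both" is an equivalence relation; there are no edges between its
-- classes, and each has odd order 2k - 1 when its cover number is k. With several classes use induction on
-- one class and on the rest. A single class has at most 4g + 1 vertices, and R(3,3) = 6, R(3,4) = 9 and the
-- uniqueness of the Ramsey graphs on 5 vertices for R(3,3) and on 13 vertices for R(3,5) finish the proof.

module Submission where

open import Defs
import Data.Bool as Bool
open import Data.Bool using (Bool; true; false; not; _∧_; if_then_else_)
open import Data.Bool.ListAction using (all; any)
open import Data.Bool.Properties using (∧-identityʳ; not-injective)
open import Data.Empty using (⊥; ⊥-elim)
open import Data.Fin using (Fin; zero; suc; splitAt; toℕ; _↑ˡ_; _↑ʳ_; #_)
import Data.Fin as Fin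
import Data.Fin.Properties as Fin
import Data.Fin.Subset as Subset
open Subset using (Subset) renaming (⊥ to ∅)
open import Data.Fin.Subset.Properties using (∉⊥; ∣⊥∣≡0)
open import Data.List
  using (List; []; _∷_; [_]; _++_; length; map; concatMap; filter; mapMaybe; upTo; allFin; tabulate; lookup)
open import Data.List.Properties using (length-++; length-map; ++-identityʳ; ++-assoc; length-tabulate)
open import Data.List.Membership.Propositional using (_∈_; _∉_; find)
open import Data.List.Membership.Propositional.Properties
open import Data.List.Relation.Binary.Permutation.Propositional
  using (_↭_; ↭-refl; ↭-sym; ↭-trans; prep; swap; ↭-reflexive)
import Data.List.Relation.Binary.Permutation.Propositional as ↭
open import Data.List.Relation.Binary.Permutation.Propositional.Properties
  using (shift; ↭-length; ∈-resp-↭; All-resp-↭; ↭-empty-inv; ++⁺ˡ; ++⁺; shifts)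
open import Data.List.Relation.Binary.Subset.Propositional using (_⊆_)
open import Data.List.Relation.Unary.All using (All; []; _∷_)
import Data.List.Relation.Unary.All as All
import Data.List.Relation.Unary.All.Properties as All
open import Data.List.Relation.Unary.AllPairs using (AllPairs; []; _∷_)
import Data.List.Relation.Unary.AllPairs as AllPairs
import Data.List.Relation.Unary.AllPairs.Properties as AllPairs
open import Data.List.Relation.Unary.Any using (Any; here; there)
import Data.List.Relation.Unary.Any as Any
import Data.List.Relation.Unary.Any.Properties as AnyP
open import Data.List.Relation.Unary.Unique.Propositional using (Unique)
import Data.List.Relation.Unary.Unique.Propositional.Properties as Uniqueₚ
open import Data.Maybe using (Maybe; just; nothing)
import Data.Maybe as Maybe
import Data.Maybe.Relation.Unary.All as MaybeAll
open import Data.Nat using (ℕ; zero; suc; _+_; _∸_; _≤_; _<_; z≤n; s≤s; s≤s⁻¹; _≡ᵇ_; _<ᵇ_)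
open import Data.Nat.Properties hiding (_≟_)
open import Data.Nat.DivMod using (_mod_)
open import Data.Nat.Tactic.RingSolver using (solve-∀)
open import Data.Product using (∃; ∃₂; _×_; _,_; proj₁; proj₂)
open import Data.Sum using (_⊎_; inj₁; inj₂; [_,_]′)
open import Data.Unit using (⊤; tt)
import Data.Vec as Vec
import Data.Vec.Properties as Vec
open import Function using (_∘_; id; _on_)
open import Function.Bundles using (mk↔ₛ′)
open import Relation.Binary.Definitions using (DecidableEquality; Symmetric)
open import Relation.Binary.PropositionalEquality using (_≡_; _≢_; refl; sym; trans; cong; cong₂; subst; subst₂)
open import Relation.Nullary using (¬_; Dec; yes; no; does)
open import Relation.Nullary.Decidable using (toSum; decidable-stable; toWitness; map′; ¬?; _×-dec_; _⊎-dec_; _→-dec_)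
open import Relation.Nullary.Negation using (¬¬-map)

-- Lists

AllPairs-resp-↭ : ∀ {A : Set} {R : A → A → Set} {xs ys} → Symmetric R → xs ↭ ys → AllPairs R xs → AllPairs R ys
AllPairs-resp-↭ s ↭.refl p = p
AllPairs-resp-↭ s (prep x σ) (px ∷ p) = All-resp-↭ σ px ∷ AllPairs-resp-↭ s σ p
AllPairs-resp-↭ s (swap x y σ) ((pxy ∷ px) ∷ py ∷ p) =
  (s pxy ∷ All-resp-↭ σ py) ∷ All-resp-↭ σ px ∷ AllPairs-resp-↭ s σ p
AllPairs-resp-↭ s (↭.trans σ τ) p = AllPairs-resp-↭ s τ (AllPairs-resp-↭ s σ p)

Unique-resp-↭ : ∀ {A : Set} {xs ys : List A} → xs ↭ ys → Unique xs → Unique ys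
Unique-resp-↭ = AllPairs-resp-↭ (_∘ sym)

AllPairs-++⁻ˡ : ∀ {A : Set} {R : A → A → Set} xs {ys} → AllPairs R (xs ++ ys) → AllPairs R xs
AllPairs-++⁻ˡ [] p = []
AllPairs-++⁻ˡ (x ∷ xs) (px ∷ p) = All.++⁻ˡ xs px ∷ AllPairs-++⁻ˡ xs p

AllPairs-++⁻ʳ : ∀ {A : Set} {R : A → A → Set} xs {ys} → AllPairs R (xs ++ ys) → AllPairs R ys
AllPairs-++⁻ʳ [] p = p
AllPairs-++⁻ʳ (x ∷ xs) (px ∷ p) = AllPairs-++⁻ʳ xs p

Unique-++-disjoint : ∀ {A : Set} (xs : List A) {ys x} → Unique (xs ++ ys) → x ∈ xs → x ∉ ys
Unique-++-disjoint (_ ∷ xs) (px ∷ _) (here refl) x∈ys = All.lookup px (∈-++⁺ʳ xs x∈ys) refl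
Unique-++-disjoint (_ ∷ xs) (_ ∷ u) (there x∈xs) = Unique-++-disjoint xs u x∈xs

∈⇒↭∷ : ∀ {A : Set} {x : A} {ys} → x ∈ ys → ∃ λ zs → ys ↭ x ∷ zs
∈⇒↭∷ x∈ys with ∈-∃++ x∈ys
... | as , bs , refl = as ++ bs , shift _ as bs

∈-∷⁻ : ∀ {A : Set} {x y : A} {ys} → x ∈ y ∷ ys → x ≢ y → x ∈ ys
∈-∷⁻ (here e) n = ⊥-elim (n e)
∈-∷⁻ (there i) n = i

⊆⇒↭++ : ∀ {A : Set} {xs ys : List A} → Unique xs → xs ⊆ ys → ∃ λ zs → ys ↭ xs ++ zs
⊆⇒↭++ {xs = []} {ys} _ _ = ys , ↭-refl
⊆⇒↭++ {xs = x ∷ xs} (px ∷ u) s with ∈⇒↭∷ (s (here refl))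
... | ys , σ with ⊆⇒↭++ u (λ i → ∈-∷⁻ (∈-resp-↭ σ (s (there i))) (λ e → All.lookup px i (sym e)))
... | zs , τ = zs , ↭-trans σ (prep x τ)

⊆⇒length≤ : ∀ {A : Set} {xs ys : List A} → Unique xs → xs ⊆ ys → length xs ≤ length ys
⊆⇒length≤ {xs = xs} u s with ⊆⇒↭++ u s
... | zs , σ = ≤-trans (m≤m+n _ (length zs)) (≤-reflexive (trans (sym (length-++ xs)) (sym (↭-length σ))))

⊆⇒↭ : ∀ {A : Set} {xs ys : List A} → Unique xs → xs ⊆ ys → length xs ≡ length ys → ys ↭ xs
⊆⇒↭ {xs = xs} u s l with ⊆⇒↭++ u s
... | [] , σ = ↭-trans σ (↭-reflexive (++-identityʳ xs))
... | z ∷ zs , σ = ⊥-elim (m+1+n≢m (length xs) (trans (sym (length-++ xs)) (trans (sym (↭-length σ)) (sym l))))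

partition-↭ : ∀ {A : Set} {P Q : A → Set} (xs : List A) → (∀ {x} → x ∈ xs → P x ⊎ Q x) →
              ∃₂ λ ys zs → xs ↭ ys ++ zs × All P ys × All Q zs
partition-↭ [] _ = [] , [] , ↭-refl , [] , []
partition-↭ (x ∷ xs) pq with partition-↭ xs (pq ∘ there) | pq (here refl)
... | ys , zs , σ , p , q | inj₁ px = x ∷ ys , zs , prep x σ , px ∷ p , q
... | ys , zs , σ , p , q | inj₂ qx = ys , x ∷ zs , ↭-trans (prep x σ) (↭-sym (shift x ys zs)) , p , qx ∷ q

tabulate-injective : ∀ {A : Set} {n} {f : Fin n → A} → Unique (tabulate f) → ∀ {i j} → f i ≡ f j → i ≡ j
tabulate-injective u {zero} {zero} e = refl
tabulate-injective (p ∷ u) {zero} {suc j} e = ⊥-elim (All.tabulate⁻ p j e)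
tabulate-injective (p ∷ u) {suc i} {zero} e = ⊥-elim (All.tabulate⁻ p i (sym e))
tabulate-injective (p ∷ u) {suc i} {suc j} e = cong suc (tabulate-injective u e)

-- Total on purpose: the variables of the search are pairs of plain numbers, so every number has to
-- name a vertex. Out of range it names `d`.
nth : ∀ {A : Set} → A → List A → ℕ → A
nth d [] n = d
nth d (x ∷ xs) zero = x
nth d (x ∷ xs) (suc n) = nth d xs n

nth-∈ : ∀ {A : Set} {d : A} {ys} xs → d ∈ ys → xs ⊆ ys → ∀ n → nth d xs n ∈ ys
nth-∈ [] d s n = d
nth-∈ (x ∷ xs) d s zero = s (here refl)
nth-∈ (x ∷ xs) d s (suc n) = nth-∈ xs d (s ∘ there) n

nth-∈′ : ∀ {A : Set} {d : A} xs {n} → n < length xs → nth d xs n ∈ xs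
nth-∈′ (x ∷ xs) {zero} _ = here refl
nth-∈′ (x ∷ xs) {suc n} (s≤s p) = there (nth-∈′ xs p)

AllPairs-nth : ∀ {A : Set} {R : A → A → Set} (d : A) {xs} → AllPairs R xs →
               AllPairs (R on nth d xs) (upTo (length xs))
AllPairs-nth {R = R} d p = AllPairs.applyUpTo⁺₁ id _ (go p)
  where
  go : ∀ {xs} → AllPairs R xs → ∀ {i j} → i < j → j < length xs → R (nth d xs i) (nth d xs j)
  go (px ∷ p) {zero} {suc j} _ (s≤s q) = All.lookup px (nth-∈′ _ q)
  go (px ∷ p) {suc i} {suc j} (s≤s r) (s≤s q) = go p r q

true≢false : ∀ {a} {A : Set} → a ≡ true → a ≡ false → A
true≢false refl ()

-- Double negation

-- Classical case distinctions are made under double negation, with this bind behind the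
-- do-notation. The final conclusion is decidable, which removes the double negation there.
_>>=_ : ∀ {A B : Set} → ¬ ¬ A → (A → ¬ ¬ B) → ¬ ¬ B
(m >>= f) k = m λ a → f a k

return : ∀ {A : Set} → A → ¬ ¬ A
return a k = k a

em⊎ : ∀ {A : Set} → ¬ ¬ (A ⊎ ¬ A)
em⊎ k = k (inj₂ (k ∘ inj₁))

¬¬-shift : ∀ {A : Set} {P : A → Set} (xs : List A) → (∀ {x} → x ∈ xs → ¬ ¬ P x) → ¬ ¬ (∀ {x} → x ∈ xs → P x)
¬¬-shift [] f k = k λ ()
¬¬-shift (x ∷ xs) f = do
  px ← f (here refl)
  g ← ¬¬-shift xs (f ∘ there)
  return λ { (here refl) → px ; (there i) → g i }

-- Satisfiability search

-- The literal (i , j , b), with i < j, says that the adjacency of i and j is b.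
Literal : Set
Literal = ℕ × ℕ × Bool

Clause : Set
Clause = List Literal

_==_ : Bool → Bool → Bool
true == b = b
false == b = not b

assignClause : Literal → Clause → Maybe Clause
assignClause ℓ [] = just []
assignClause ℓ@(i , j , b) ((k , l , c) ∷ C) =
  if (i ≡ᵇ k) ∧ (j ≡ᵇ l)
  then (if b == c then nothing else assignClause ℓ C)
  else Maybe.map ((k , l , c) ∷_) (assignClause ℓ C)

assign : Literal → List Clause → List Clause
assign ℓ = mapMaybe (assignClause ℓ)

-- Prefers the first empty or unit clause, so conflicts and forced literals come before any
-- branching. The default is the clause whose first literal is branched on.
pick : Clause → List Clause → Clause
pick C [] = C
pick C ([] ∷ φ) = []
pick C (D@(_ ∷ []) ∷ φ) = D
pick C (_ ∷ φ) = pick C φ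

dpll : (List Literal → Bool) → ℕ → List Literal → List Clause → Bool
dpll leaf zero α φ = false
dpll leaf (suc n) α [] = leaf α
dpll leaf (suc n) α φ@(C ∷ φ′) with pick C (C ∷ φ′)
... | [] = true
... | ℓ ∷ [] = dpll leaf n (ℓ ∷ α) (assign ℓ φ)
... | ℓ@(i , j , b) ∷ _ ∷ _ =
  dpll leaf n (ℓ ∷ α) (assign ℓ φ) ∧ dpll leaf n ((i , j , not b) ∷ α) (assign (i , j , not b) φ)

∧-true : ∀ {a b} → a ∧ b ≡ true → a ≡ true × b ≡ true
∧-true {true} p = refl , p

≡ᵇ⇒≡′ : ∀ {m n} → (m ≡ᵇ n) ≡ true → m ≡ n
≡ᵇ⇒≡′ {m} {n} p = ≡ᵇ⇒≡ m n (subst Bool.T (sym p) tt)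

==⇒≡ : ∀ {a b} → (a == b) ≡ true → a ≡ b
==⇒≡ {true} {true} _ = refl
==⇒≡ {false} {false} _ = refl

==-false : ∀ {a b} → (a == b) ≡ false → ¬ (a ≡ b)
==-false {true} {false} _ ()
==-false {false} {true} _ ()

≡-or-not : ∀ a b → a ≡ b ⊎ a ≡ not b
≡-or-not false false = inj₁ refl
≡-or-not false true = inj₂ refl
≡-or-not true false = inj₂ refl
≡-or-not true true = inj₁ refl

module _ (ρ : ℕ → ℕ → Bool) where

  Holds : Literal → Set
  Holds (i , j , b) = ρ i j ≡ b

  assignClause-sound : ∀ ℓ C → Holds ℓ → Any Holds C → MaybeAll.All (Any Holds) (assignClause ℓ C)
  assignClause-sound ℓ@(i , j , b) ((k , l , c) ∷ C) hℓ hC with (i ≡ᵇ k) ∧ (j ≡ᵇ l) in same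
  assignClause-sound ℓ@(i , j , b) ((k , l , c) ∷ C) hℓ hC | true with b == c in eq
  ... | true = MaybeAll.nothing
  assignClause-sound ℓ@(i , j , b) ((k , l , c) ∷ C) hℓ (there hC) | true | false = assignClause-sound ℓ C hℓ hC
  -- A literal that is dropped contradicts `ℓ`, so it cannot be the one that holds.
  assignClause-sound ℓ@(i , j , b) ((k , l , c) ∷ C) hℓ (here p) | true | false
    with refl ← ≡ᵇ⇒≡′ {i} {k} (proj₁ (∧-true same)) | refl ← ≡ᵇ⇒≡′ {j} {l} (proj₂ (∧-true {i ≡ᵇ k} same)) =
    ⊥-elim (==-false eq (trans (sym hℓ) p))
  assignClause-sound ℓ (_ ∷ C) hℓ (there hC) | false with assignClause ℓ C | assignClause-sound ℓ C hℓ hC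
  ... | just D | MaybeAll.just hD = MaybeAll.just (there hD)
  ... | nothing | _ = MaybeAll.nothing
  assignClause-sound ℓ (_ ∷ C) hℓ (here p) | false with assignClause ℓ C
  ... | just D = MaybeAll.just (here p)
  ... | nothing = MaybeAll.nothing

  assign-sound : ∀ ℓ {φ} → Holds ℓ → All (Any Holds) φ → All (Any Holds) (assign ℓ φ)
  assign-sound ℓ hℓ hφ = All.mapMaybe⁺ (All.map⁺ (All.map (assignClause-sound ℓ _ hℓ) hφ))

  pick-sound : ∀ {C φ} → Any Holds C → All (Any Holds) φ → Any Holds (pick C φ)
  pick-sound hC [] = hC
  pick-sound {φ = (_ ∷ []) ∷ _} hC (hD ∷ _) = hD
  pick-sound {φ = (_ ∷ _ ∷ _) ∷ _} hC (_ ∷ hφ) = pick-sound hC hφ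

  -- The model `ρ` selects one branch of the search tree. No empty clause occurs on it, and
  -- exhausted fuel counts as failure, so the branch ends in an assignment that `leaf` accepts.
  dpll-sound : ∀ leaf n α φ → dpll leaf n α φ ≡ true → All Holds α → All (Any Holds) φ →
               ∃ λ β → leaf β ≡ true × All Holds β
  dpll-sound leaf (suc n) α [] e hα _ = α , e , hα
  dpll-sound leaf (suc n) α φ@(C ∷ φ′) e hα hφ with pick C (C ∷ φ′) | pick-sound (All.head hφ) hφ
  ... | ℓ ∷ [] | here hℓ = dpll-sound leaf n _ _ e (hℓ ∷ hα) (assign-sound ℓ hℓ hφ)
  ... | ℓ@(i , j , b) ∷ _ ∷ _ | _ with ≡-or-not (ρ i j) b
  ...   | inj₁ hℓ = dpll-sound leaf n _ _ (proj₁ (∧-true e)) (hℓ ∷ hα) (assign-sound ℓ hℓ hφ)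
  ...   | inj₂ hℓ = dpll-sound leaf n _ _ (proj₂ (∧-true {dpll leaf n (ℓ ∷ α) (assign ℓ φ)} e)) (hℓ ∷ hα)
      (assign-sound _ hℓ hφ)

-- Ramsey conditions as clauses, and recognising a graph from its literals

choose : ∀ {A : Set} → ℕ → List A → List (List A)
choose zero xs = [] ∷ []
choose (suc k) [] = []
choose (suc k) (x ∷ xs) = map (x ∷_) (choose k xs) ++ choose (suc k) xs

choose-All : ∀ {A : Set} {P : A → Set} k {xs} → All P xs → ∀ {S} → S ∈ choose k xs → All P S
choose-All zero p (here refl) = []
choose-All (suc k) {x ∷ xs} (px ∷ p) i with ∈-++⁻ (map (x ∷_) (choose k xs)) i
... | inj₂ j = choose-All (suc k) p j
... | inj₁ j with ∈-map⁻ (x ∷_) j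
... | _ , j′ , refl = px ∷ choose-All k p j′

choose-AllPairs : ∀ {A : Set} {R : A → A → Set} k {xs} → AllPairs R xs → ∀ {S} → S ∈ choose k xs → AllPairs R S
choose-AllPairs zero p (here refl) = []
choose-AllPairs (suc k) {x ∷ xs} (px ∷ p) i with ∈-++⁻ (map (x ∷_) (choose k xs)) i
... | inj₂ j = choose-AllPairs (suc k) p j
... | inj₁ j with ∈-map⁻ (x ∷_) j
... | _ , j′ , refl = choose-All k px j′ ∷ choose-AllPairs k p j′

choose-length : ∀ {A : Set} k (xs : List A) {S} → S ∈ choose k xs → length S ≡ k
choose-length zero xs (here refl) = refl
choose-length (suc k) (x ∷ xs) i with ∈-++⁻ (map (x ∷_) (choose k xs)) i
... | inj₂ j = choose-length (suc k) xs j
... | inj₁ j with ∈-map⁻ (x ∷_) j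
... | _ , j′ , refl = cong suc (choose-length k xs j′)

someEqual : Bool → List ℕ → Clause
someEqual b [] = []
someEqual b (x ∷ xs) = map (λ y → x , y , b) xs ++ someEqual b xs

-- The models are the triangle-free graphs on 0, …, m - 1 without independent sets of size a + 1.
ramsey : ℕ → ℕ → List Clause
ramsey m a = map (someEqual false) (choose 3 (upTo m)) ++ map (someEqual true) (choose (suc a) (upTo m))

someEqual-sound : ∀ ρ b S → ¬ AllPairs (λ i j → ρ i j ≡ not b) S → Any (Holds ρ) (someEqual b S)
someEqual-sound ρ b [] ¬p = ⊥-elim (¬p [])
someEqual-sound ρ b (x ∷ xs) ¬p with row xs
  where
  row : ∀ ys → Any (Holds ρ) (map (λ y → x , y , b) ys) ⊎ All (λ y → ρ x y ≡ not b) ys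
  row [] = inj₂ []
  row (y ∷ ys) with ≡-or-not (ρ x y) b | row ys
  ... | inj₁ p | _ = inj₁ (here p)
  ... | inj₂ p | inj₁ q = inj₁ (there q)
  ... | inj₂ p | inj₂ q = inj₂ (p ∷ q)
... | inj₁ p = AnyP.++⁺ˡ p
... | inj₂ p = AnyP.++⁺ʳ _ (someEqual-sound ρ b xs λ q → ¬p (p ∷ q))

value : List Literal → ℕ → ℕ → Maybe Bool
value [] i j = nothing
value ((k , l , b) ∷ α) i j = if (i ≡ᵇ k) ∧ (j ≡ᵇ l) then just b else value α i j

edge : List Literal → ℕ → ℕ → Maybe Bool
edge α i j = if i <ᵇ j then value α i j else if j <ᵇ i then value α j i else just false

agrees : Maybe Bool → Bool → Bool
agrees nothing _ = false
agrees (just b) c = b == c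

agrees⇒≡ : ∀ x {b} → agrees x b ≡ true → x ≡ just b
agrees⇒≡ (just a) p = cong just (==⇒≡ p)

all-true : ∀ {A : Set} (p : A → Bool) xs → all p xs ≡ true → ∀ {x} → x ∈ xs → p x ≡ true
all-true p (x ∷ xs) e (here refl) = proj₁ (∧-true e)
all-true p (x ∷ xs) e (there i) = all-true p xs (proj₂ (∧-true {p x} e)) i

any-true : ∀ {A : Set} (p : A → Bool) xs → any p xs ≡ true → ∃ λ x → p x ≡ true
any-true p (x ∷ xs) e with p x in q
... | true = x , q
... | false = any-true p xs e

module _ {m : ℕ} (P : Fin m → Fin m → Bool) where

  copies : List Literal → List (Fin m) → List (Fin m × ℕ) → List (List (Fin m × ℕ))
  copies α [] π = π ∷ []
  copies α (i ∷ is) π = concatMap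
    (λ c → if all (λ { (k , d) → agrees (edge α c d) (P i k) }) π then copies α is ((i , c) ∷ π) else [])
    (upTo m)

  image : List (Fin m × ℕ) → Fin m → ℕ
  image [] i = 0
  image ((k , c) ∷ π) i = if does (i Fin.≟ k) then c else image π i

  -- Tests a candidate from scratch, so the backtracking in `copies` needs no correctness proof.
  isCopy : List Literal → List (Fin m × ℕ) → Bool
  isCopy α π = all (λ i → all (λ j → agrees (edge α (image π i) (image π j)) (P i j)) (allFin m)) (allFin m)

  hasCopy : List Literal → Bool
  hasCopy α = any (isCopy α) (copies α (allFin m) [])

  hasCopy-sound : ∀ α → hasCopy α ≡ true → ∃ λ f → ∀ i j → edge α (f i) (f j) ≡ just (P i j)
  hasCopy-sound α e with any-true (isCopy α) (copies α (allFin m) []) e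
  ... | π , p = image π , λ i j →
    agrees⇒≡ (edge α (image π i) (image π j))
        (all-true _ (allFin m) (all-true _ (allFin m) p (∈-allFin i)) (∈-allFin j))

value-sound : ∀ ρ α {i j b} → All (Holds ρ) α → value α i j ≡ just b → ρ i j ≡ b
value-sound ρ ((k , l , c) ∷ α) {i} {j} (hc ∷ hα) e with (i ≡ᵇ k) ∧ (j ≡ᵇ l) in same
... | false = value-sound ρ α hα e
... | true with refl ← e | refl ← ≡ᵇ⇒≡′ {i} {k} (proj₁ (∧-true same)) | refl ← ≡ᵇ⇒≡′ {j} {l} (proj₂ (∧-true {i ≡ᵇ k} same)) = hc

<ᵇ-false : ∀ {m n} → (m <ᵇ n) ≡ false → n ≤ m
<ᵇ-false {m} {n} e = ≮⇒≥ λ p → subst Bool.T e (<⇒<ᵇ p)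

edge-sound : ∀ ρ α {i j b} → (∀ i j → ρ i j ≡ ρ j i) → (∀ i → ρ i i ≡ false) → All (Holds ρ) α →
             edge α i j ≡ just b → ρ i j ≡ b
edge-sound ρ α {i} {j} s r hα e with i <ᵇ j in p
... | true = value-sound ρ α hα e
... | false with j <ᵇ i in q
... | true = trans (s i j) (value-sound ρ α hα e)
... | false with refl ← ≤-antisym (<ᵇ-false {i} p) (<ᵇ-false {j} q) | refl ← e = r i

-- The three pieces and the computer searches

co : ∀ {m} → Graph m → Fin m → Fin m → Bool
co P i j = not (adj P i j) ∧ not (does (i Fin.≟ j))

-- The complements of these graphs have clique cover number minus independence number 0, 1 and 3.
data Shape : Set where
  point pentagon thirteen : Shape

size gapOf : Shape → ℕ
size point = 1
size pentagon = 5
size thirteen = 13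
gapOf point = 0
gapOf pentagon = 1
gapOf thirteen = 3

shape : ∀ s → Graph (size s)
shape point = K 1
shape pentagon = C5
shape thirteen = Q

-- Both complements are vertex-transitive circulants; i - j = ±2 is an edge of the first, ±1 of the second.
nearPerfectMatching : ∀ s → Fin (size s) → List (Fin (size s) × Fin (size s))
nearPerfectMatching point i = []
nearPerfectMatching pentagon i =
    map (λ (a , b) → (toℕ i + a) mod 5 , (toℕ i + b) mod 5) ((2 , 4) ∷ (1 , 3) ∷ [])
nearPerfectMatching thirteen i =
  map (λ a → (toℕ i + a) mod 13 , (toℕ i + suc a) mod 13) (1 ∷ 3 ∷ 5 ∷ 7 ∷ 9 ∷ 11 ∷ [])

-- One clique through `i` together with the matching covers the piece by its order minus twice its
-- gap, which is the count that `Better` has to beat.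
npm-length : ∀ s i → suc (length (nearPerfectMatching s i)) + (gapOf s + gapOf s) ≡ size s
npm-length point i = refl
npm-length pentagon i = refl
npm-length thirteen i = refl

npm-edges : ∀ s i → All (λ (a , b) → co (shape s) a b ≡ true) (nearPerfectMatching s i)
npm-edges point i = []
npm-edges pentagon = toWitness {a? = Fin.all? λ i → All.all? (λ (a , b) → co C5 a b Bool.≟ true) _} _
npm-edges thirteen = toWitness {a? = Fin.all? λ i → All.all? (λ (a , b) → co Q a b Bool.≟ true) _} _

npm-covers : ∀ s i j → j ≡ i ⊎ Any (λ (a , b) → j ≡ a ⊎ j ≡ b) (nearPerfectMatching s i)
npm-covers point zero zero = inj₁ refl
npm-covers pentagon = toWitness {a? = Fin.all? λ i → Fin.all? λ j →
  (j Fin.≟ i) ⊎-dec Any.any? (λ (a , b) → (j Fin.≟ a) ⊎-dec (j Fin.≟ b)) _} _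
npm-covers thirteen = toWitness {a? = Fin.all? λ i → Fin.all? λ j →
  (j Fin.≟ i) ⊎-dec Any.any? (λ (a , b) → (j Fin.≟ a) ⊎-dec (j Fin.≟ b)) _} _

-- 0 is a vertex, 1 2 3 are its neighbours, 4 … 8 its non-neighbours, a pentagon labelled as the complement of C5.
known9 : List Literal
known9 = map (λ j → 0 , j , true) (1 ∷ 2 ∷ 3 ∷ []) ++ map (λ j → 0 , j , false) (4 ∷ 5 ∷ 6 ∷ 7 ∷ 8 ∷ [])
  ++ (4 , 6 , true) ∷ (6 , 8 , true) ∷ (5 , 8 , true) ∷ (5 , 7 , true) ∷ (4 , 7 , true) ∷ []

-- 0 and 5 are non-adjacent with common neighbours 1 and 2; 3 4 are the other neighbours of 0, 6 7 those of 5;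
-- 8 … 12 are adjacent to neither and form a pentagon labelled as the complement of C5.
known13 : List Literal
known13 = map (λ j → 0 , j , true) (1 ∷ 2 ∷ 3 ∷ 4 ∷ [])
  ++ map (λ j → 0 , j , false) (5 ∷ 6 ∷ 7 ∷ 8 ∷ 9 ∷ 10 ∷ 11 ∷ 12 ∷ [])
  ++ (1 , 5 , true) ∷ (2 , 5 , true) ∷ (5 , 6 , true) ∷ (5 , 7 , true)
  ∷ map (λ j → 5 , j , false) (8 ∷ 9 ∷ 10 ∷ 11 ∷ 12 ∷ [])
  ++ (8 , 10 , true) ∷ (10 , 12 , true) ∷ (9 , 12 , true) ∷ (9 , 11 , true) ∷ (8 , 11 , true) ∷ []

-- 500 is fuel, more than the depth of the search trees.
search : (List Literal → Bool) → List Literal → ℕ → ℕ → Bool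
search leaf known m a = dpll leaf 500 [] (map [_] known ++ ramsey m a)

-- A record instead of a bare equation, so that certificates are compared by their parameters and
-- not by evaluating `search`.
record Verified (leaf : List Literal → Bool) (known : List Literal) (m a : ℕ) : Set where
  constructor verified
  field result : search leaf known m a ≡ true

search5 : Verified (hasCopy (co (shape pentagon))) [] 5 2
search5 = verified refl

-- The leaf test rejects every assignment, so success means that there is no model.
search9 : Verified (λ _ → false) known9 9 3
search9 = verified refl

search13 : Verified (hasCopy (co (shape thirteen))) known13 13 4
search13 = verified refl

-- Clique covers and independent sets in the complement

module Complement {V : Set} (_≟_ : DecidableEquality V) (h : V → V → Bool)
                  (h-sym : ∀ x y → h x y ≡ h y x) (h-irrefl : ∀ x → h x x ≡ false) where

  open import Data.List.Membership.DecPropositional _≟_ using (_∈?_)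

  edge-or-not : ∀ x y → h x y ≡ true ⊎ h x y ≡ false
  edge-or-not x y with h x y
  ... | true = inj₁ refl
  ... | false = inj₂ refl

  flip-edge : ∀ {x y b} → h x y ≡ b → h y x ≡ b
  flip-edge {x} {y} e = trans (h-sym y x) e

  edge⇒≢ : ∀ {x y} → h x y ≡ true → x ≢ y
  edge⇒≢ {x} e refl with () ← trans (sym e) (h-irrefl x)

  Clique : List V → Set
  Clique C = ∀ x y → x ∈ C → y ∈ C → x ≡ y ⊎ h x y ≡ true

  -- Here h is the adjacency of the complement, so covers by cliques are colourings of the graph.
  Cov : List V → ℕ → Set
  Cov W k = ∃ λ L → length L ≤ k × All Clique L × (∀ {x} → x ∈ W → Any (x ∈_) L)

  Ind : List V → ℕ → Set
  Ind W m = ∃ λ I → length I ≡ m × I ⊆ W × Unique I × AllPairs (λ x y → h x y ≡ false) I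

  NoEdges : List V → List V → Set
  NoEdges U W = ∀ {x y} → x ∈ U → y ∈ W → h x y ≡ false

  -- Cover number minus independence number is at least `g`; quantifying over all covers and
  -- independent sets avoids choosing optimal ones.
  Gap : ℕ → List V → Set
  Gap g W = ∀ {k m} → Cov W k → Ind W m → m + g ≤ k

  -- A cover with fewer cliques than a union of pieces of total gap g needs.
  Better : ℕ → List V → Set
  Better g W = ∃ λ k → Cov W k × suc (k + (g + g)) ≤ length W

  clique-⊆ : ∀ {C D} → C ⊆ D → Clique D → Clique C
  clique-⊆ s c x y i j = c x y (s i) (s j)

  clique-1 : ∀ x → Clique (x ∷ [])
  clique-1 x _ _ (here refl) (here refl) = inj₁ refl

  clique-∷ : ∀ {x C} → (∀ {y} → y ∈ C → x ≡ y ⊎ h x y ≡ true) → Clique C → Clique (x ∷ C)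
  clique-∷ f c _ _ (here refl) (here refl) = inj₁ refl
  clique-∷ f c _ _ (here refl) (there j) = f j
  clique-∷ f c _ _ (there i) (here refl) with f i
  ... | inj₁ e = inj₁ (sym e)
  ... | inj₂ e = inj₂ (flip-edge e)
  clique-∷ f c _ _ (there i) (there j) = c _ _ i j

  clique-2 : ∀ {x y} → h x y ≡ true → Clique (x ∷ y ∷ [])
  clique-2 e = clique-∷ (λ { (here refl) → inj₂ e }) (clique-1 _)

  cov-⊆ : ∀ {U W k} → U ⊆ W → Cov W k → Cov U k
  cov-⊆ s (L , l , c , m) = L , l , c , m ∘ s

  cov-[] : Cov [] 0
  cov-[] = [] , z≤n , [] , λ ()

  cov-∷ : ∀ {C W k} → Clique C → Cov W k → Cov (C ++ W) (suc k)
  cov-∷ {C} cC (L , l , c , m) = C ∷ L , s≤s l , cC ∷ c , λ i → [ here , there ∘ m ]′ (∈-++⁻ C i)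

  cov-++ : ∀ {U W k l} → Cov U k → Cov W l → Cov (U ++ W) (k + l)
  cov-++ {U} (L , l , c , m) (L′ , l′ , c′ , m′) =
    L ++ L′ , ≤-trans (≤-reflexive (length-++ L)) (+-mono-≤ l l′) , All.++⁺ c c′ ,
    λ i → [ AnyP.++⁺ˡ ∘ m , AnyP.++⁺ʳ L ∘ m′ ]′ (∈-++⁻ U i)

  ⊆-↭ : ∀ {U W : List V} → U ↭ W → U ⊆ W
  ⊆-↭ σ = ∈-resp-↭ σ

  cov-↭ : ∀ {U W k} → U ↭ W → Cov U k → Cov W k
  cov-↭ σ = cov-⊆ (⊆-↭ (↭-sym σ))

  ind-⊆ : ∀ {U W m} → U ⊆ W → Ind U m → Ind W m
  ind-⊆ s (I , l , i , r) = I , l , s ∘ i , r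

  ind-[] : ∀ {W} → Ind W 0
  ind-[] = [] , refl , (λ ()) , [] , []

  ind-∷ : ∀ {x W m} ((I , _) : Ind W m) → x ∉ I → (∀ {y} → y ∈ I → h x y ≡ false) → Ind (x ∷ W) (suc m)
  ind-∷ (I , l , s , u , a) n f =
    _ ∷ I , cong suc l , (λ { (here e) → here e ; (there i) → there (s i) }) ,
    All.tabulate (λ { i refl → n i }) ∷ u , All.tabulate f ∷ a

  ind-++ : ∀ {U W k l} → NoEdges U W → (∀ {x} → x ∈ U → x ∉ W) → Ind U k → Ind W l → Ind (U ++ W) (k + l)
  ind-++ {U} e d (I , l , s , u , a) (I′ , l′ , s′ , u′ , a′) =
    I ++ I′ , trans (length-++ I) (cong₂ _+_ l l′) ,
    (λ i → [ ∈-++⁺ˡ ∘ s , ∈-++⁺ʳ U ∘ s′ ]′ (∈-++⁻ I i)) ,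
    AllPairs.++⁺ u u′ (All.tabulate λ i → All.tabulate λ { j refl → d (s i) (s′ j) }) ,
    AllPairs.++⁺ a a′ (All.tabulate λ i → All.tabulate λ j → e (s i) (s′ j))

  gap-↭ : ∀ {g U W} → U ↭ W → Gap g U → Gap g W
  gap-↭ σ G c i = G (cov-↭ (↭-sym σ) c) (ind-⊆ (⊆-↭ (↭-sym σ)) i)

  -- Decompositions into points, pentagons and copies of the complement of Q

  Copy : ∀ s → (Fin (size s) → V) → Set
  Copy s f = ∀ i j → h (f i) (f j) ≡ co (shape s) i j

  data Decomp : ℕ → List V → Set where
    nil : Decomp 0 []
    cons : ∀ {g g′ U W} s f → Copy s f → Decomp g U → NoEdges (tabulate f) U →
           W ↭ tabulate f ++ U → g′ ≡ gapOf s + g → Decomp g′ W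

  decomp-↭ : ∀ {g U W} → U ↭ W → Decomp g U → Decomp g W
  decomp-↭ σ nil with refl ← ↭-empty-inv (↭-sym σ) = nil
  decomp-↭ σ (cons s f c D n τ e) = cons s f c D n (↭-trans (↭-sym σ) τ) e

  decomp-++ : ∀ {g g′ U W} → Decomp g U → Decomp g′ W → NoEdges U W → Decomp (g + g′) (U ++ W)
  decomp-++ nil D′ n = D′
  decomp-++ {g′ = g′} {W = W} (cons {g = g} {U = U} s f c D m σ e) D′ n =
    cons s f c (decomp-++ D D′ λ i → n (⊆-↭ (↭-sym σ) (∈-++⁺ʳ (tabulate f) i)))
      (λ i j → [ m i , n (⊆-↭ (↭-sym σ) (∈-++⁺ˡ i)) ]′ (∈-++⁻ U j))
      (↭-trans (++⁺ σ ↭-refl) (↭-reflexive (++-assoc (tabulate f) U W)))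
      (trans (cong (_+ g′) e) (+-assoc (gapOf s) g g′))

  decomp-point : ∀ {g U} v → Decomp g U → (∀ {y} → y ∈ U → h v y ≡ false) → Decomp g (v ∷ U)
  decomp-point v D n = cons point (λ _ → v) (λ { zero zero → h-irrefl v }) D (λ { (here refl) → n }) ↭-refl refl

  -- The piece without `f i` has a perfect matching, so the clique that covers `f i` is free to
  -- reach outside the piece: it is a single vertex in `decomp-cov` and may be an outgoing edge in
  -- `decomp-augment`.
  copy-cov : ∀ s f → Copy s f → ∀ i {C} → Clique C → f i ∈ C →
             ∃ λ k → Cov (C ++ tabulate f) k × k + (gapOf s + gapOf s) ≡ size s
  copy-cov s f c i {C} cC fi∈C =
    _ , (C ∷ map pair M , s≤s (≤-reflexive (length-map pair M)) ,
         cC ∷ All.map⁺ (All.map (λ {(a , b)} e → clique-2 (trans (c a b) e)) (npm-edges s i)) ,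
         λ x∈ → [ here , covered ]′ (∈-++⁻ C x∈)) ,
    npm-length s i
    where
    M = nearPerfectMatching s i
    pair : Fin (size s) × Fin (size s) → List V
    pair (a , b) = f a ∷ f b ∷ []
    covered : ∀ {x} → x ∈ tabulate f → Any (x ∈_) (C ∷ map pair M)
    covered x∈ with ∈-tabulate⁻ x∈
    ... | j , refl with npm-covers s i j
    ... | inj₁ refl = here fi∈C
    ... | inj₂ p = there (AnyP.map⁺
        (Any.map (λ { (inj₁ refl) → here refl ; (inj₂ refl) → there (here refl) }) p))

  anchor : ∀ s → Fin (size s)
  anchor point = zero
  anchor pentagon = zero
  anchor thirteen = zero

  cons-sum : ∀ k l s g {u a n w} → k + (s + s) ≡ n → l + (g + g) ≡ u → a ≡ s + g → w ≡ n + u →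
      (k + l) + (a + a) ≡ w
  cons-sum k l s g refl refl refl refl = lemma k l s g
    where
    lemma : ∀ k l s g → (k + l) + ((s + g) + (s + g)) ≡ (k + (s + s)) + (l + (g + g))
    lemma = solve-∀

  cons-length : ∀ {s U W} (f : Fin (size s) → V) → W ↭ tabulate f ++ U → length W ≡ size s + length U
  cons-length f σ = trans (↭-length σ) (trans (length-++ (tabulate f)) (cong (_+ _) (length-tabulate f)))

  decomp-cov : ∀ {g W} → Decomp g W → ∃ λ k → Cov W k × k + (g + g) ≡ length W
  decomp-cov nil = 0 , cov-[] , refl
  decomp-cov (cons s f c D n σ e) with decomp-cov D | copy-cov s f c (anchor s) (clique-1 _) (here refl)
  ... | l , covD , el | k , covS , ek =
    k + l , cov-⊆ (there ∘ ⊆-↭ σ) (cov-++ covS covD) , cons-sum k l (gapOf s) _ ek el e (cons-length f σ)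

  -- The edge from `v` serves as the clique through `w`, so the additional vertex costs no
  -- additional clique.
  decomp-augment : ∀ {g W v w} → Decomp g W → w ∈ W → h v w ≡ true →
                   ∃ λ k → Cov (v ∷ W) k × k + (g + g) ≡ length W
  decomp-augment (cons {U = U} s f c D n σ e) w∈ vw with ∈-++⁻ (tabulate f) (⊆-↭ σ w∈)
  ... | inj₁ i with ∈-tabulate⁻ i
  ... | j , refl with decomp-cov D | copy-cov s f c j (clique-2 vw) (there (here refl))
  ... | l , covD , el | k , covS , ek =
    k + l , cov-⊆ (λ { (here refl) → here refl ; (there i) → there (there (⊆-↭ σ i)) }) (cov-++ covS covD) ,
    cons-sum k l (gapOf s) _ ek el e (cons-length f σ)
  decomp-augment {v = v} (cons {U = U} s f c D n σ e) w∈ vw | inj₂ i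
    with decomp-augment D i vw | copy-cov s f c (anchor s) (clique-1 _) (here refl)
  ... | l , covD , el | k , covS , ek =
    k + l , cov-⊆ (λ { (here refl) → there (∈-++⁺ʳ (tabulate f) (here refl))
                     ; (there i) → [ there ∘ ∈-++⁺ˡ , there ∘ ∈-++⁺ʳ (tabulate f) ∘ there ]′
                                     (∈-++⁻ (tabulate f) (⊆-↭ σ i)) })
                   (cov-++ covS covD) ,
    cons-sum k l (gapOf s) _ ek el e (cons-length f σ)

  -- Absorbing a clique into a decomposition

  -- The pentagon is the cycle 0 2 4 1 3 of the complement. A clique all of whose members are absorbed
  -- is covered together with the pentagon by three cliques, extending 0, 2 4 and 1 3.
  AbsorbedBy : V → ∀ s → (Fin (size s) → V) → Set
  AbsorbedBy t point f = h t (f zero) ≡ true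
  AbsorbedBy t pentagon f =
    h t (f (# 0)) ≡ true ⊎ (h t (f (# 2)) ≡ true × h t (f (# 4)) ≡ true) ⊎
        (h t (f (# 1)) ≡ true × h t (f (# 3)) ≡ true)
  AbsorbedBy t thirteen f = ⊥

  Absorbed : ∀ {g W} → V → Decomp g W → Set
  Absorbed t nil = ⊥
  Absorbed t (cons s f _ D _ _ _) = AbsorbedBy t s f ⊎ Absorbed t D

  extend-clique : ∀ {C T} → Clique C → Clique T → All (λ t → All (λ c → h t c ≡ true) C) T → Clique (C ++ T)
  extend-clique {C} cC cT a x y i j with ∈-++⁻ C i | ∈-++⁻ C j
  ... | inj₁ p | inj₁ q = cC x y p q
  ... | inj₁ p | inj₂ q = inj₂ (flip-edge (All.lookup (All.lookup a q) p))
  ... | inj₂ p | inj₁ q = inj₂ (All.lookup (All.lookup a p) q)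
  ... | inj₂ p | inj₂ q = cT x y p q

  absorb-copy : ∀ s f → Copy s f → ∀ {T} → Clique T → All (λ t → AbsorbedBy t s f) T →
                ∃ λ k → Cov (T ++ tabulate f) k × k + (gapOf s + gapOf s) ≡ size s
  absorb-copy point f c {T} cT a =
    1 , cov-⊆ (λ i → [ there ∘ ∈-++⁺ˡ , (λ { (here refl) → here refl }) ]′ (∈-++⁻ T i))
              (cov-∷ (extend-clique (clique-1 _) cT (All.map (_∷ []) a)) cov-[]) , refl
  absorb-copy pentagon f c {T} cT a
    with partition-↭ {P = λ t → h t (f (# 0)) ≡ true} T (All.lookup a)
  ... | T₀ , T₁ , σ , a₀ , a₁ with partition-↭ T₁ (All.lookup a₁)
  ... | T₂ , T₃ , τ , a₂ , a₃ =
    3 , (L , ≤-refl ,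
         extend-clique (clique-1 _) (clique-⊆ T₀⊆ cT) (All.map (_∷ []) a₀) ∷
         extend-clique (clique-2 (c (# 2) (# 4))) (clique-⊆ T₂⊆ cT) (All.map (λ (p , q) → p ∷ q ∷ []) a₂) ∷
         extend-clique (clique-2 (c (# 1) (# 3))) (clique-⊆ T₃⊆ cT) (All.map (λ (p , q) → p ∷ q ∷ []) a₃) ∷ [] ,
         λ i → [ inT , inF ]′ (∈-++⁻ T i)) , refl
    where
    L = (f (# 0) ∷ T₀) ∷ (f (# 2) ∷ f (# 4) ∷ T₂) ∷ (f (# 1) ∷ f (# 3) ∷ T₃) ∷ []
    T₀⊆ : T₀ ⊆ T
    T₀⊆ i = ⊆-↭ (↭-sym σ) (∈-++⁺ˡ i)
    T₂⊆ : T₂ ⊆ T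
    T₂⊆ i = ⊆-↭ (↭-sym σ) (∈-++⁺ʳ T₀ (⊆-↭ (↭-sym τ) (∈-++⁺ˡ i)))
    T₃⊆ : T₃ ⊆ T
    T₃⊆ i = ⊆-↭ (↭-sym σ) (∈-++⁺ʳ T₀ (⊆-↭ (↭-sym τ) (∈-++⁺ʳ T₂ i)))
    inT : ∀ {x} → x ∈ T → Any (x ∈_) L
    inT i with ∈-++⁻ T₀ (⊆-↭ σ i)
    ... | inj₁ j = here (there j)
    ... | inj₂ j with ∈-++⁻ T₂ (⊆-↭ τ j)
    ... | inj₁ k = there (here (there (there k)))
    ... | inj₂ k = there (there (here (there (there k))))
    inF : ∀ {x} → x ∈ tabulate f → Any (x ∈_) L
    inF (here refl) = here (here refl)
    inF (there (here refl)) = there (there (here (here refl)))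
    inF (there (there (here refl))) = there (here (here refl))
    inF (there (there (there (here refl)))) = there (there (here (there (here refl))))
    inF (there (there (there (there (here refl))))) = there (here (there (here refl)))
  absorb-copy thirteen f c {[]} cT [] with copy-cov thirteen f c (# 0) (clique-1 _) (here refl)
  ... | k , cov , e = k , cov-⊆ there cov , e

  -- Each member of `T` goes to a piece that absorbs it. The members sent to one piece still form a
  -- clique, and they enlarge cliques in the cover of that piece without adding any.
  absorb : ∀ {g W T} (D : Decomp g W) → Clique T → All (λ t → Absorbed t D) T →
           ∃ λ k → Cov (T ++ W) k × k + (g + g) ≡ length W
  absorb nil cT [] = 0 , cov-[] , refl
  absorb {T = T} (cons {U = U} s f c D n σ e) cT a with partition-↭ T (All.lookup a)
  ... | T₁ , T₂ , τ , a₁ , a₂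
    with absorb D (clique-⊆ (⊆-↭ (↭-sym τ) ∘ ∈-++⁺ʳ T₁) cT) a₂
       | absorb-copy s f c (clique-⊆ (⊆-↭ (↭-sym τ) ∘ ∈-++⁺ˡ) cT) a₁
  ... | l , covD , el | k , covS , ek = k + l , cov-⊆ sub (cov-++ covS covD) ,
      cons-sum k l (gapOf s) _ ek el e (cons-length f σ)
    where
    sub : T ++ _ ⊆ (T₁ ++ tabulate f) ++ (T₂ ++ U)
    sub i with ∈-++⁻ T i
    ... | inj₁ j with ∈-++⁻ T₁ (⊆-↭ τ j)
    ...   | inj₁ p = ∈-++⁺ˡ (∈-++⁺ˡ p)
    ...   | inj₂ p = ∈-++⁺ʳ (T₁ ++ tabulate f) (∈-++⁺ˡ p)
    sub i | inj₂ j with ∈-++⁻ (tabulate f) (⊆-↭ σ j)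
    ...   | inj₁ p = ∈-++⁺ˡ (∈-++⁺ʳ T₁ p)
    ...   | inj₂ p = ∈-++⁺ʳ (T₁ ++ tabulate f) (∈-++⁺ʳ T₂ p)

  IndAvoiding : V → List V → ℕ → Set
  IndAvoiding t W m = ∃ λ ((I , _) : Ind W m) → ∀ {x} → x ∈ I → h t x ≡ false

  ind-pair : ∀ {x y W} → x ∈ W → y ∈ W → x ≢ y → h x y ≡ false → Ind W 2
  ind-pair {x} {y} i j n e =
    x ∷ y ∷ [] , refl , (λ { (here refl) → i ; (there (here refl)) → j }) , (n ∷ []) ∷ [] ∷ [] ,
        (e ∷ []) ∷ [] ∷ []

  avoid-pair : ∀ s {t f} → Copy s f → Unique (tabulate f) → ∀ i j → i ≢ j → co (shape s) i j ≡ false →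
               h t (f i) ≡ false → h t (f j) ≡ false → IndAvoiding t (tabulate f) 2
  avoid-pair s c u i j n p a b =
    ind-pair (∈-tabulate⁺ i) (∈-tabulate⁺ j) (n ∘ tabulate-injective u) (trans (c i j) p) ,
    λ { (here refl) → a ; (there (here refl)) → b }

  -- A vertex not absorbed by the pentagon misses 0, one of 2 and 4, and one of 1 and 3; among such
  -- three vertices two are non-adjacent. The order minus three times the gap is the independence
  -- number of the piece.
  absorbed-or-avoids : ∀ t s f → Copy s f → Unique (tabulate f) → gapOf s ≤ 2 →
    AbsorbedBy t s f ⊎ (∃ λ m → IndAvoiding t (tabulate f) m × m + (gapOf s + gapOf s + gapOf s) ≡ size s)
  absorbed-or-avoids t point f c u _ with edge-or-not t (f zero)
  ... | inj₁ e = inj₁ e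
  ... | inj₂ e = inj₂ (1 , ((f zero ∷ [] , refl , id , [] ∷ [] , [] ∷ []) , λ { (here refl) → e }) , refl)
  absorbed-or-avoids t pentagon f c u _
    with edge-or-not t (f (# 0)) | edge-or-not t (f (# 1)) | edge-or-not t (f (# 2)) | edge-or-not t (f (# 3))
        | edge-or-not t (f (# 4))
  ... | inj₁ e₀ | _ | _ | _ | _ = inj₁ (inj₁ e₀)
  ... | _ | inj₁ e₁ | _ | inj₁ e₃ | _ = inj₁ (inj₂ (inj₂ (e₁ , e₃)))
  ... | _ | _ | inj₁ e₂ | _ | inj₁ e₄ = inj₁ (inj₂ (inj₁ (e₂ , e₄)))
  ... | inj₂ e₀ | inj₂ e₁ | _ | _ | _ = inj₂ (2 , avoid-pair pentagon c u (# 0) (# 1) (λ ()) refl e₀ e₁ , refl)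
  ... | inj₂ e₀ | _ | _ | _ | inj₂ e₄ = inj₂ (2 , avoid-pair pentagon c u (# 0) (# 4) (λ ()) refl e₀ e₄ , refl)
  ... | _ | inj₁ e₁ | inj₂ e₂ | inj₂ e₃ | inj₁ e₄ =
      inj₂ (2 , avoid-pair pentagon c u (# 2) (# 3) (λ ()) refl e₂ e₃ , refl)
  absorbed-or-avoids t thirteen f c u (s≤s (s≤s ()))

  three-sum : ∀ m l s g {u a n w} → m + (s + s + s) ≡ n → l + (g + g + g) ≡ u → a ≡ s + g → w ≡ n + u →
              (m + l) + (a + a + a) ≡ w
  three-sum m l s g refl refl refl refl = lemma m l s g
    where
    lemma : ∀ m l s g → (m + l) + ((s + g) + (s + g) + (s + g)) ≡ (m + (s + s + s)) + (l + (g + g + g))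
    lemma = solve-∀

  absorbed-or-avoids-all : ∀ {g W} t (D : Decomp g W) → Unique W → g ≤ 2 →
    Absorbed t D ⊎ (∃ λ m → IndAvoiding t W m × m + (g + g + g) ≡ length W)
  absorbed-or-avoids-all t nil u _ = inj₂ (0 , (ind-[] , λ ()) , refl)
  absorbed-or-avoids-all t (cons {g = g} s f c D n σ refl) u g≤2
    with u′ ← Unique-resp-↭ σ u
    with absorbed-or-avoids t s f c (AllPairs-++⁻ˡ _ u′) (≤-trans (m≤m+n (gapOf s) g) g≤2)
       | absorbed-or-avoids-all t D (AllPairs-++⁻ʳ (tabulate f) u′) (≤-trans (m≤n+m g (gapOf s)) g≤2)
  ... | inj₁ p | _ = inj₁ (inj₁ p)
  ... | _ | inj₁ p = inj₁ (inj₂ p)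
  ... | inj₂ (m , (I , a) , e) | inj₂ (l , (J , b) , e′) =
    inj₂ (m + l , (ind-⊆ (⊆-↭ (↭-sym σ)) (ind-++ n (Unique-++-disjoint (tabulate f) u′) I J) ,
                   λ i → [ a , b ]′ (∈-++⁻ (proj₁ I) i)) ,
          three-sum m l (gapOf s) g e e′ refl (cons-length f σ))

  -- Matchings

  -- An involution of all of `V` whose fixed points are the unmatched vertices. A matching of a
  -- subset is then literally a matching of the larger set.
  record Matching (W : List V) : Set where
    field
      partner : V → V
      involutive : ∀ x → partner (partner x) ≡ x
      edges : ∀ x → partner x ≡ x ⊎ h x (partner x) ≡ true
      inside : ∀ {x} → partner x ≢ x → x ∈ W
  open Matching

  fixed : (V → V) → List V → List V
  fixed p = filter (λ x → p x ≟ x)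

  ∈-fixed⁺ : ∀ p {W x} → x ∈ W → p x ≡ x → x ∈ fixed p W
  ∈-fixed⁺ p = ∈-filter⁺ (λ x → p x ≟ x)

  ∈-fixed⁻ : ∀ p W {x} → x ∈ fixed p W → x ∈ W × p x ≡ x
  ∈-fixed⁻ p W = ∈-filter⁻ (λ x → p x ≟ x) {xs = W}

  Unique-fixed : ∀ {W} p → Unique W → Unique (fixed p W)
  Unique-fixed p = AllPairs.filter⁺ (λ x → p x ≟ x)

  ∉⇒All≢ : ∀ {x : V} {xs} → x ∉ xs → All (x ≢_) xs
  ∉⇒All≢ n = All.tabulate λ { i refl → n i }

  involution-injective : ∀ {p : V → V} → (∀ x → p (p x) ≡ x) → ∀ {x y} → p x ≡ p y → x ≡ y
  involution-injective {p} inv {x} {y} e = trans (sym (inv x)) (trans (cong p e) (inv y))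

  partner∈ : ∀ {W} (M : Matching W) {x} → x ∈ W → partner M x ∈ W
  partner∈ M {x} x∈W with partner M x ≟ x
  ... | yes e = subst (_∈ _) (sym e) x∈W
  ... | no n = inside M λ e → n (trans (sym e) (involutive M x))

  -- Matches x with y and leaves the former partner of y unmatched.
  rematch : (V → V) → V → V → V → V
  rematch p x y e with e ≟ x | e ≟ y | e ≟ p y
  ... | yes _ | _ | _ = y
  ... | no _ | yes _ | _ = x
  ... | no _ | no _ | yes _ = e
  ... | no _ | no _ | no _ = p e

  module _ (p : V → V) (x y : V) (x≢y : x ≢ y) where

    rematch-x : rematch p x y x ≡ y
    rematch-x with x ≟ x
    ... | yes _ = refl
    ... | no n = ⊥-elim (n refl)

    rematch-y : rematch p x y y ≡ x
    rematch-y with y ≟ x | y ≟ y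
    ... | yes e | _ = ⊥-elim (x≢y (sym e))
    ... | no _ | yes _ = refl
    ... | no _ | no n = ⊥-elim (n refl)

    rematch-z : ∀ {e} → e ≢ x → e ≢ y → e ≡ p y → rematch p x y e ≡ e
    rematch-z {e} a b c with e ≟ x | e ≟ y | e ≟ p y
    ... | yes q | _ | _ = ⊥-elim (a q)
    ... | no _ | yes q | _ = ⊥-elim (b q)
    ... | no _ | no _ | yes _ = refl
    ... | no _ | no _ | no q = ⊥-elim (q c)

    rematch-other : ∀ {e} → e ≢ x → e ≢ y → e ≢ p y → rematch p x y e ≡ p e
    rematch-other {e} a b c with e ≟ x | e ≟ y | e ≟ p y
    ... | yes q | _ | _ = ⊥-elim (a q)
    ... | no _ | yes q | _ = ⊥-elim (b q)
    ... | no _ | no _ | yes q = ⊥-elim (c q)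
    ... | no _ | no _ | no _ = refl

    rematch-fixed : ∀ {e} → rematch p x y e ≡ e → e ≢ x × e ≢ y × (e ≡ p y ⊎ p e ≡ e)
    rematch-fixed {e} f with e ≟ x | e ≟ y | e ≟ p y
    ... | yes refl | _ | _ = ⊥-elim (x≢y (sym f))
    ... | no _ | yes refl | _ = ⊥-elim (x≢y f)
    ... | no a | no b | yes c = a , b , inj₁ c
    ... | no a | no b | no _ = a , b , inj₂ f

  -- If `y` is unmatched this adds an edge; otherwise the old partner of `y` takes the place of `x`
  -- among the unmatched vertices.
  attach : ∀ {W} (M : Matching W) {x y} → x ∈ W → y ∈ W → partner M x ≡ x → h x y ≡ true → Matching W
  attach {W} M {x} {y} x∈W y∈W px xy = record
    { partner = q ; involutive = inv ; edges = edg ; inside = ins }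
    where
    p = partner M
    q = rematch p x y
    x≢y = edge⇒≢ xy
    inv : ∀ e → q (q e) ≡ e
    inv e with e ≟ x | e ≟ y | e ≟ p y
    ... | yes refl | _ | _ = rematch-y p x y x≢y
    ... | no _ | yes refl | _ = rematch-x p x y x≢y
    ... | no a | no b | yes c = rematch-z p x y x≢y a b c
    ... | no a | no b | no c = trans
      (rematch-other p x y x≢y (λ s → a (involution-injective (involutive M) (trans s (sym px))))
        (λ s → c (trans (sym (involutive M e)) (cong p s))) (b ∘ involution-injective (involutive M)))
      (involutive M e)
    edg : ∀ e → q e ≡ e ⊎ h e (q e) ≡ true
    edg e with e ≟ x | e ≟ y | e ≟ p y
    ... | yes refl | _ | _ = inj₂ xy
    ... | no _ | yes refl | _ = inj₂ (flip-edge xy)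
    ... | no _ | no _ | yes _ = inj₁ refl
    ... | no _ | no _ | no _ = edges M e
    ins : ∀ {e} → q e ≢ e → e ∈ W
    ins {e} n with e ≟ x | e ≟ y | e ≟ p y
    ... | yes refl | _ | _ = x∈W
    ... | no _ | yes refl | _ = y∈W
    ... | no _ | no _ | yes _ = ⊥-elim (n refl)
    ... | no _ | no _ | no _ = inside M n

  -- Covers and matchings of triangle-free sets

  TriangleFree : List V → Set
  TriangleFree W = ∀ {x y z} → x ∈ W → y ∈ W → z ∈ W → h x y ≡ true → h y z ≡ true → h x z ≡ true → ⊥

  matching-⊆ : ∀ {U W} → U ⊆ W → Matching U → Matching W
  matching-⊆ s M = record
    { partner = partner M ; involutive = involutive M ; edges = edges M ; inside = s ∘ inside M }

  fixed-⊆ : ∀ {U W p q} → Unique U → (∀ {x} → x ∈ U → p x ≡ x → x ∈ W × q x ≡ x) →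
            length (fixed p U) ≤ length (fixed q W)
  fixed-⊆ {U} {p = p} {q} u f = ⊆⇒length≤ (Unique-fixed p u) λ i →
    let (a , b) = ∈-fixed⁻ p U i ; (c , d) = f a b in ∈-fixed⁺ q c d

  fixed-∷ : ∀ {x U} p → length (fixed p (x ∷ U)) ≤ suc (length (fixed p U))
  fixed-∷ {x} p with p x ≟ x
  ... | yes _ = ≤-refl
  ... | no _ = n≤1+n _

  matching-↭ : ∀ {U W k} → Unique U → U ↭ W →
      (∃ λ (M : Matching U) → length U + length (fixed (partner M) U) ≤ k) →
               ∃ λ (M : Matching W) → length W + length (fixed (partner M) W) ≤ k
  matching-↭ u σ (M , l) = matching-⊆ (⊆-↭ σ) M ,
    ≤-trans (+-mono-≤ (≤-reflexive (sym (↭-length σ)))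
      (fixed-⊆ (Unique-resp-↭ σ u) λ i e → ⊆-↭ (↭-sym σ) i , e)) l

  -- Without triangles each clique contains at most two vertices not treated yet: two become an
  -- edge, a single one stays unmatched. Order plus unmatched vertices is twice the number of edges
  -- and unmatched vertices together, hence at most twice the number of cliques.
  cov⇒matching : ∀ (L : List (List V)) {W} → Unique W → TriangleFree W → All Clique L →
      (∀ {x} → x ∈ W → Any (x ∈_) L) →
                 ∃ λ (M : Matching W) → length W + length (fixed (partner M) W) ≤ length L + length L
  cov⇒matching [] {[]} u t cL m = record
    { partner = id ; involutive = λ _ → refl ; edges = λ _ → inj₁ refl ; inside = λ n → ⊥-elim (n refl) } , z≤n
  cov⇒matching [] {x ∷ W} u t cL m with () ← m (here refl)
  cov⇒matching (C ∷ L) {W} u t (cC ∷ cL) m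
    with partition-↭ {P = _∈ C} {Q = _∉ C} W (λ {x} _ → decide x)
    where
    decide : ∀ x → x ∈ C ⊎ x ∉ C
    decide x with x ∈? C
    ... | yes i = inj₁ i
    ... | no n = inj₂ n
  ... | I , O , σ , inC , outC = go I σ inC
    where
    O⊆W : ∀ {I} → W ↭ I ++ O → O ⊆ W
    O⊆W {I} σ i = ⊆-↭ (↭-sym σ) (∈-++⁺ʳ I i)
    uO = AllPairs-++⁻ʳ I (Unique-resp-↭ σ u)
    ih : ∃ λ (M : Matching O) → length O + length (fixed (partner M) O) ≤ length L + length L
    ih = cov⇒matching L uO (λ i j k → t (O⊆W σ i) (O⊆W σ j) (O⊆W σ k)) cL λ i →
      [ (λ j → ⊥-elim (All.lookup outC i j)) , id ]′ (Any.toSum (m (O⊆W σ i)))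
    bound : ∀ {a b l} → a ≤ l + l → b ≤ 2 + a → b ≤ suc l + suc l
    bound {l = l} p q = ≤-trans q (≤-trans (s≤s (s≤s p)) (≤-reflexive (cong suc (sym (+-suc l l)))))
    go : ∀ I → W ↭ I ++ O → All (_∈ C) I → ∃ λ (M : Matching W) →
         length W + length (fixed (partner M) W) ≤ suc (length L) + suc (length L)
    go [] σ _ with ih
    ... | M , l = matching-↭ uO (↭-sym σ) (M , ≤-trans l (+-mono-≤ (n≤1+n _) (n≤1+n _)))
    go (x ∷ []) σ _ with ih
    ... | M , l = matching-↭ (Unique-resp-↭ σ u) (↭-sym σ)
      (matching-⊆ there M , bound l
        (s≤s (≤-trans (+-monoʳ-≤ (length O) (fixed-∷ (partner M))) (≤-reflexive (+-suc _ _)))))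
    go (x ∷ y ∷ []) σ (x∈C ∷ y∈C ∷ []) with ih | Unique-resp-↭ σ u
    ... | M , l | ((x≢y ∷ x∉O) ∷ y∉O ∷ uO) = matching-↭ (Unique-resp-↭ σ u) (↭-sym σ)
      (N , bound l (s≤s (s≤s (+-monoʳ-≤ (length O) fewer))))
      where
      xy : h x y ≡ true
      xy = [ (λ e → ⊥-elim (x≢y e)) , id ]′ (cC x y x∈C y∈C)
      fix∉O : ∀ {z} → z ∉ O → partner M z ≡ z
      fix∉O {z} n with partner M z ≟ z
      ... | yes e = e
      ... | no d = ⊥-elim (n (inside M d))
      N : Matching (x ∷ y ∷ O)
      N = attach (matching-⊆ (there ∘ there) M) (here refl) (there (here refl))
          (fix∉O λ i → All.lookup x∉O i refl) xy
      py : partner M y ≡ y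
      py = fix∉O λ i → All.lookup y∉O i refl
      fewer : length (fixed (partner N) (x ∷ y ∷ O)) ≤ length (fixed (partner M) O)
      fewer = fixed-⊆ (Unique-resp-↭ σ u) λ i e → let (a , b , c) = rematch-fixed (partner M) x y x≢y e in
        ∈-∷⁻ (∈-∷⁻ i a) b , [ (λ d → ⊥-elim (b (trans d py))) , id ]′ c
    go (x ∷ y ∷ z ∷ I) σ (x∈C ∷ y∈C ∷ z∈C ∷ _) with Unique-resp-↭ σ u
    ... | (x≢y ∷ x≢z ∷ _) ∷ (y≢z ∷ _) ∷ _ =
        ⊥-elim (t (w (here refl)) (w (there (here refl))) (w (there (there (here refl))))
      ([ (λ e → ⊥-elim (x≢y e)) , id ]′ (cC x y x∈C y∈C))
      ([ (λ e → ⊥-elim (y≢z e)) , id ]′ (cC y z y∈C z∈C))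
      ([ (λ e → ⊥-elim (x≢z e)) , id ]′ (cC x z x∈C z∈C)))
      where
      w : ∀ {v} → v ∈ x ∷ y ∷ z ∷ I ++ O → v ∈ W
      w = ⊆-↭ (↭-sym σ)

  -- Converse of `cov⇒matching`: the cliques are the edges and the fixed points. Only closure of `U`
  -- under `p` is asked, so that it applies to one Gallai class. `n` bounds the recursion, which may
  -- remove a vertex together with its partner.
  closed⇒cov : ∀ n (p : V → V) U → length U ≤ n → (∀ x → p (p x) ≡ x) → (∀ x → p x ≡ x ⊎ h x (p x) ≡ true) →
               Unique U → (∀ {x} → x ∈ U → p x ∈ U) → ∃ λ k → Cov U k × k + k ≤ length U + length (fixed p U)
  closed⇒cov n p [] l inv edg u cl = 0 , cov-[] , z≤n
  closed⇒cov (suc n) p (x ∷ U) (s≤s l) inv edg (x∉U ∷ u) cl with p x ≟ x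
  ... | yes px with closed⇒cov n p U l inv edg u
                      (λ {y} i → ∈-∷⁻ (cl (there i)) λ e →
                          All.lookup x∉U i (involution-injective inv (trans px (sym e))))
  ... | k , c , b = suc k , cov-∷ (clique-1 x) c ,
    s≤s (subst₂ _≤_ (sym (+-suc k k)) (sym (+-suc _ _)) (s≤s b))
  closed⇒cov (suc n) p (x ∷ U) (s≤s l) inv edg (x∉U ∷ u) cl | no px
    with ∈⇒↭∷ (∈-∷⁻ (cl (here refl)) px)
  ... | U′ , σ with Unique-resp-↭ σ u
  ... | px∉U′ ∷ u′ with closed⇒cov n p U′ (≤-trans (n≤1+n _) (≤-trans (≤-reflexive (sym (↭-length σ))) l)) inv
      edg u′
    (λ {y} i → ∈-∷⁻ (⊆-↭ σ (∈-∷⁻ (cl (there (⊆-↭ (↭-sym σ) (there i))))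
                  λ e → All.lookup px∉U′ i (involution-injective inv (trans (inv x) (sym e)))))
                λ e → All.lookup x∉U (⊆-↭ (↭-sym σ) (there i)) (sym (involution-injective inv e)))
  ... | k , c , b = suc k ,
    cov-⊆ (λ { (here refl) → here refl ; (there i) → there (⊆-↭ σ i) })
      (cov-∷ (clique-2 ([ (λ e → ⊥-elim (px e)) , id ]′ (edg x))) c) ,
    s≤s (subst₂ _≤_ (sym (+-suc k k)) (cong (_+ length (fixed p U)) (sym (↭-length σ)))
      (s≤s (≤-trans b (+-monoʳ-≤ (length U′) (fixed-⊆ u′ λ i e → ⊆-↭ (↭-sym σ) (there i) , e)))))

  missed : ∀ {W} → Matching W → List V
  missed {W} M = fixed (partner M) W

  ∈-missed⁺ : ∀ {W} (M : Matching W) {x} → x ∈ W → partner M x ≡ x → x ∈ missed M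
  ∈-missed⁺ M = ∈-fixed⁺ (partner M)

  ∈-missed⁻ : ∀ {W} (M : Matching W) {x} → x ∈ missed M → x ∈ W × partner M x ≡ x
  ∈-missed⁻ {W} M = ∈-fixed⁻ (partner M) W

  Optimal : ∀ {W} → Matching W → Set
  Optimal {W} M = ∀ (N : Matching W) → length (missed M) ≤ length (missed N)

  -- Gallai's lemma

  module Gallai {W : List V} (uW : Unique W)
                (critical : ∀ {v} → v ∈ W → ¬ ¬ (∃ λ (M : Matching W) → partner M v ≡ v × Optimal M)) where

    -- No optimal matching misses both vertices, unless they coincide; the exception makes the
    -- relation reflexive.
    Linked : V → V → Set
    Linked u w = ∀ (M : Matching W) → Optimal M → partner M u ≡ u → partner M w ≡ w → u ≡ w

    no-free-edge : ∀ (M : Matching W) → Optimal M → ∀ {x y} → x ∈ W → y ∈ W → partner M x ≡ x →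
        partner M y ≡ y → h x y ≡ true → ⊥
    no-free-edge M o {x} {y} x∈ y∈ px py xy = 1+n≰n (≤-trans
      (⊆⇒length≤ {xs = x ∷ missed (attach M x∈ y∈ px xy)}
        (∉⇒All≢ (λ i → proj₁ (rf (proj₂ (∈-missed⁻ (attach M x∈ y∈ px xy) i))) refl) ∷ Unique-fixed _ uW)
        λ { (here refl) → ∈-missed⁺ M x∈ px
          ; (there i) → let (a , b) = ∈-missed⁻ (attach M x∈ y∈ px xy) i ; (_ , c , d) = rf b in
                        ∈-missed⁺ M a ([ (λ e → ⊥-elim (c (trans e py))) , id ]′ d) })
      (o (attach M x∈ y∈ px xy)))
      where
      rf : ∀ {e} → rematch (partner M) x y e ≡ e → e ≢ x × e ≢ y × (e ≡ partner M y ⊎ partner M e ≡ e)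
      rf = rematch-fixed (partner M) x y (edge⇒≢ xy)

    edge⇒linked : ∀ {x y} → x ∈ W → y ∈ W → h x y ≡ true → Linked x y
    edge⇒linked x∈ y∈ xy M o px py = ⊥-elim (no-free-edge M o x∈ y∈ px py xy)

    -- Among the missed vertices `x` disappears and at most the old partner of `y` is new, so their
    -- number does not grow.
    attach-optimal : ∀ (N : Matching W) {x y} (x∈ : x ∈ W) (y∈ : y ∈ W) (px : partner N x ≡ x)
        (xy : h x y ≡ true) →
                     Optimal N → Optimal (attach N x∈ y∈ px xy)
    attach-optimal N {x} {y} x∈ y∈ px xy o K =
        ≤-trans (s≤s⁻¹ (⊆⇒length≤ {xs = x ∷ missed N′} {ys = partner N y ∷ missed N}
      (∉⇒All≢ (λ i → proj₁ (rf (proj₂ (∈-missed⁻ N′ i))) refl) ∷ Unique-fixed _ uW)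
      λ { (here refl) → there (∈-missed⁺ N x∈ px)
        ; (there i) → let (a , b) = ∈-missed⁻ N′ i ; (_ , _ , d) = rf b in [ here , there ∘ ∈-missed⁺ N a ]′ d })) (o K)
      where
      N′ = attach N x∈ y∈ px xy
      rf : ∀ {e} → rematch (partner N) x y e ≡ e → e ≢ x × e ≢ y × (e ≡ partner N y ⊎ partner N e ≡ e)
      rf = rematch-fixed (partner N) x y (edge⇒≢ xy)

    disagreement : Matching W → Matching W → List V
    disagreement M N = filter (λ x → ¬? (partner M x ≟ partner N x)) W

    ∈-disagreement⁺ : ∀ M N {x} → x ∈ W → partner M x ≢ partner N x → x ∈ disagreement M N
    ∈-disagreement⁺ M N = ∈-filter⁺ (λ x → ¬? (partner M x ≟ partner N x))

    ∈-disagreement⁻ : ∀ M N {x} → x ∈ disagreement M N → x ∈ W × partner M x ≢ partner N x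
    ∈-disagreement⁻ M N = ∈-filter⁻ (λ x → ¬? (partner M x ≟ partner N x)) {xs = W}

    -- Gallai's exchange: an optimal matching N missing t but neither u nor w misses some x ≠ t that M covers;
    -- matching x as M does keeps N optimal and brings it closer to M.
    exchange : ∀ (M : Matching W) → Optimal M → ∀ {u w t} → u ∈ W → w ∈ W → u ≢ w → partner M u ≡ u →
        partner M w ≡ w →
               Linked u t → Linked t w → t ∈ W → partner M t ≢ t →
               ∀ n (N : Matching W) → length (disagreement M N) ≤ n → Optimal N → partner N t ≡ t → ⊥
    exchange M oM {u} {w} {t} u∈ w∈ u≢w pu pw ut tw t∈ Mt n N dis oN Nt
      with Any.any? (λ x → (partner N x ≟ x) ×-dec ¬? (x ≟ t) ×-dec ¬? (partner M x ≟ x)) W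
    -- Apart from `t`, everything `N` misses is missed by `M`. But `M` also misses `u` and `w`,
    -- which `N` covers because both are linked to `t`; so `M` misses more than `N` and is not
    -- optimal.
    ... | no none = 1+n≰n (≤-trans two one)
      where
      rest = filter (λ x → ¬? (x ≟ t)) (missed N)
      ∈-rest⁻ : ∀ {x} → x ∈ rest → x ≢ t × partner N x ≡ x × partner M x ≡ x
      ∈-rest⁻ {x} i with ∈-filter⁻ (λ x → ¬? (x ≟ t)) {xs = missed N} i
      ... | j , x≢t with ∈-missed⁻ N j
      ... | x∈ , Nx with partner M x ≟ x
      ... | yes Mx = x≢t , Nx , Mx
      ... | no Mx = ⊥-elim (none (Any.map (λ { refl → Nx , x≢t , Mx }) x∈))
      u∉ : u ∉ rest
      u∉ i = let (a , b , _) = ∈-rest⁻ i in a (ut N oN b Nt)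
      w∉ : w ∉ rest
      w∉ i = let (a , b , _) = ∈-rest⁻ i in a (sym (tw N oN Nt b))
      two : 2 + length rest ≤ length (missed M)
      two = ⊆⇒length≤ ((u≢w ∷ ∉⇒All≢ u∉) ∷ ∉⇒All≢ w∉ ∷ AllPairs.filter⁺ _ (Unique-fixed _ uW))
        λ { (here refl) → ∈-missed⁺ M u∈ pu
          ; (there (here refl)) → ∈-missed⁺ M w∈ pw
          ; (there (there i)) → ∈-missed⁺ M
              (proj₁ (∈-missed⁻ N (proj₁ (∈-filter⁻ (λ x → ¬? (x ≟ t)) {xs = missed N} i))))
              (proj₂ (proj₂ (∈-rest⁻ i))) }
      one : length (missed M) ≤ suc (length rest)
      one = ≤-trans (oM N) (⊆⇒length≤ {ys = t ∷ rest} (Unique-fixed _ uW) λ {x} i → split x i)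
        where
        split : ∀ x → x ∈ missed N → x ∈ t ∷ rest
        split x i with x ≟ t
        ... | yes refl = here refl
        ... | no x≢t = there (∈-filter⁺ (λ x → ¬? (x ≟ t)) i x≢t)
    ... | yes some with find some
    ... | x , x∈ , Nx , x≢t , Mx with n | dis | ≤-trans
        (∈-length (∈-disagreement⁺ M N x∈ λ e → Mx (trans e Nx))) dis
    ... | suc n | dis′ | s≤s _ = exchange M oM u∈ w∈ u≢w pu pw ut tw t∈ Mt n N′ closer
        (attach-optimal N x∈ y∈ Nx xy oN) N′t
      where
      y = partner M x
      y∈ = partner∈ M x∈
      xy : h x y ≡ true
      xy = [ (λ e → ⊥-elim (Mx e)) , id ]′ (edges M x)
      x≢y = edge⇒≢ xy
      N′ = attach N x∈ y∈ Nx xy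
      Ny : partner N y ≢ y
      Ny e = no-free-edge N oN x∈ y∈ Nx e xy
      t≢y : t ≢ y
      t≢y refl = Ny Nt
      N′t : partner N′ t ≡ t
      N′t = [ rematch-z (partner N) x y x≢y (x≢t ∘ sym) t≢y
            , (λ d → trans (rematch-other (partner N) x y x≢y (x≢t ∘ sym) t≢y d) Nt) ]′
                (toSum (t ≟ partner N y))
      -- `N′` follows `M` at `x` and `y`. It also changes the old partner of `y`, where `M` and `N`
      -- cannot agree since `M` matches `y` with `x`. So no disagreement is new, and the one at `x`
      -- is gone.
      N′-agrees-or-N : ∀ {e} → partner M e ≢ partner N′ e → e ≢ x × partner M e ≢ partner N e
      N′-agrees-or-N {e} d = e≢x , λ a → d (trans a (sym (N′≡N a)))
        where
        e≢x : e ≢ x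
        e≢x refl = d (sym (rematch-x (partner N) x y x≢y))
        e≢y : e ≢ y
        e≢y refl = d (trans (involutive M x) (sym (rematch-y (partner N) x y x≢y)))
        N′≡N : partner M e ≡ partner N e → partner N′ e ≡ partner N e
        N′≡N a =
          [ (λ b → ⊥-elim (e≢x (involution-injective (involutive M)
              (trans a (trans (cong (partner N) b) (involutive N y))))))
          , rematch-other (partner N) x y x≢y e≢x e≢y ]′ (toSum (e ≟ partner N y))
      closer : length (disagreement M N′) ≤ n
      closer = s≤s⁻¹ (≤-trans (⊆⇒length≤ {xs = x ∷ disagreement M N′} {ys = disagreement M N}
        (∉⇒All≢ (λ i → proj₁ (N′-agrees-or-N (proj₂ (∈-disagreement⁻ M N′ i))) refl) ∷ AllPairs.filter⁺ _ uW)
        λ { (here refl) → ∈-disagreement⁺ M N x∈ λ e → Mx (trans e Nx)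
          ; (there i) → let (a , b) = ∈-disagreement⁻ M N′ i in ∈-disagreement⁺ M N a (proj₂ (N′-agrees-or-N b)) }) dis′)

    -- If `M` misses distinct `u` and `w`, it covers `t`, since otherwise both would equal `t`. By
    -- criticality some optimal matching misses `t`, and `exchange` applies.
    linked-trans : ∀ {u t w} → u ∈ W → t ∈ W → w ∈ W → Linked u t → Linked t w → Linked u w
    linked-trans {u} {t} {w} u∈ t∈ w∈ ut tw M oM pu pw with u ≟ w
    ... | yes e = e
    ... | no u≢w = ⊥-elim (critical t∈ λ (N , Nt , oN) →
      exchange M oM u∈ w∈ u≢w pu pw ut tw t∈ (λ Mt → u≢w (trans (ut M oM pu Mt) (tw M oM Mt pw)))
        (length (disagreement M N)) N ≤-refl oN Nt)

  -- Ramsey numbers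

  NoInd : List V → ℕ → Set
  NoInd W a = ∀ {m} → Ind W m → m ≤ a

  TriangleFree-⊆ : ∀ {U W} → U ⊆ W → TriangleFree W → TriangleFree U
  TriangleFree-⊆ s t i j k = t (s i) (s j) (s k)

  NoInd-⊆ : ∀ {U W a} → U ⊆ W → NoInd W a → NoInd U a
  NoInd-⊆ s n = n ∘ ind-⊆ s

  All⇒AllPairs : ∀ {R : V → V → Set} {W} → (∀ {x y} → x ∈ W → y ∈ W → R x y) → AllPairs R W
  All⇒AllPairs {W = []} r = []
  All⇒AllPairs {W = x ∷ W} r = All.tabulate (r (here refl) ∘ there) ∷ All⇒AllPairs λ i j → r (there i) (there j)

  star : ∀ v W → ∃₂ λ N M → W ↭ N ++ M × All (λ x → h v x ≡ true) N × All (λ x → h v x ≡ false) M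
  star v W = partition-↭ W λ _ → edge-or-not v _

  -- The neighbours of a vertex are independent, as an edge between them closes a triangle.
  neighbours≤ : ∀ {v W N a} → TriangleFree W → NoInd W a → v ∈ W → N ⊆ W → Unique N →
      All (λ x → h v x ≡ true) N → length N ≤ a
  neighbours≤ t n v∈ s u e = n (_ , refl , s , u , All⇒AllPairs λ {x} {y} i j →
    [ (λ xy → ⊥-elim (t v∈ (s i) (s j) (All.lookup e i) xy (All.lookup e j))) , id ]′ (edge-or-not x y))

  NoInd-nonneighbours : ∀ {v W M a} → NoInd W (suc a) → v ∈ W → v ∉ M → M ⊆ W → All (λ x → h v x ≡ false) M →
      NoInd M a
  NoInd-nonneighbours n v∈ v∉ s e i@(I , _ , I⊆ , _) =
    s≤s⁻¹ (n (ind-⊆ (λ { (here refl) → v∈ ; (there j) → s j }) (ind-∷ i (v∉ ∘ I⊆) (All.lookup e ∘ I⊆))))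

  Bound : ℕ → ℕ → Set
  Bound a r = ∀ {W} → Unique W → TriangleFree W → NoInd W a → length W ≤ r

  module _ {v W} (u : Unique (v ∷ W)) (t : TriangleFree (v ∷ W)) {a} (n : NoInd (v ∷ W) (suc a)) where

    star-bounds : ∀ {N M} → W ↭ N ++ M → All (λ x → h v x ≡ true) N → All (λ x → h v x ≡ false) M →
                  length N ≤ suc a × NoInd M a
    star-bounds {N} {M} σ eN eM =
      neighbours≤ t n (here refl) (λ i → there (⊆-↭ (↭-sym σ) (∈-++⁺ˡ i)))
          (AllPairs-++⁻ˡ N (Unique-resp-↭ σ (AllPairs.tail u))) eN ,
      NoInd-nonneighbours n (here refl) (λ i → All.lookup (AllPairs.head u) (M⊆ i) refl) (there ∘ M⊆) eM
      where
      M⊆ : M ⊆ W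
      M⊆ i = ⊆-↭ (↭-sym σ) (∈-++⁺ʳ N i)

  -- Counts a vertex, its neighbours and its non-neighbours: the classical R(3, a + 2) ≤ R(3, a + 1)
  -- + a + 2.
  bound-suc : ∀ {a r} → Bound a r → Bound (suc a) (suc (suc a + r))
  bound-suc b {[]} u t n = z≤n
  bound-suc b {v ∷ W} u t n with star v W
  ... | N , M , σ , eN , eM with star-bounds u t n σ eN eM
  ... | lN , nM = s≤s (≤-trans (≤-reflexive (trans (↭-length σ) (length-++ N)))
    (+-mono-≤ lN (b (AllPairs-++⁻ʳ N (Unique-resp-↭ σ (AllPairs.tail u)))
        (TriangleFree-⊆ (λ i → there (⊆-↭ (↭-sym σ) (∈-++⁺ʳ N i))) t) nM)))

  bound₀ : Bound 0 0
  bound₀ {[]} u t n = z≤n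
  bound₀ {x ∷ W} u t n with () ← n {1} (x ∷ [] , refl , (λ { (here refl) → here refl }) , [] ∷ [] , [] ∷ [])

  bound₁ : Bound 1 2
  bound₁ = bound-suc bound₀

  bound₂ : Bound 2 5
  bound₂ = bound-suc bound₁

  adjacency : V → List V → ℕ → ℕ → Bool
  adjacency d L i j = h (nth d L i) (nth d L j)

  module _ (d : V) (L : List V) {a : ℕ} (u : Unique L) (t : TriangleFree L) (n : NoInd L a) where

    ρ : ℕ → ℕ → Bool
    ρ = adjacency d L

    in-range : ∀ k {S} → S ∈ choose k (upTo (length L)) → All (λ i → nth d L i ∈ L) S
    in-range k = choose-All k (All.map (nth-∈′ L) (All.all-upTo (length L)))

    no-triangle : ∀ {S} → S ∈ choose 3 (upTo (length L)) → ¬ AllPairs (λ i j → ρ i j ≡ true) S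
    no-triangle S∈ p with choose-length 3 (upTo (length L)) S∈ | in-range 3 S∈ | p
    no-triangle {_ ∷ _ ∷ _ ∷ []} S∈ p | refl | i ∷ j ∷ k ∷ [] | (ij ∷ ik ∷ []) ∷ (jk ∷ []) ∷ _ =
        t i j k ij jk ik

    no-independent : ∀ {S} → S ∈ choose (suc a) (upTo (length L)) → ¬ AllPairs (λ i j → ρ i j ≡ false) S
    no-independent {S} S∈ p = 1+n≰n (n (map (nth d L) S ,
      trans (length-map (nth d L) S) (choose-length (suc a) (upTo (length L)) S∈) ,
      (λ i → let (j , j∈ , e) = ∈-map⁻ (nth d L) i in subst (_∈ L) (sym e) (All.lookup (in-range (suc a) S∈) j∈)) ,
      AllPairs.map⁺ (choose-AllPairs (suc a) (AllPairs-nth d u) S∈) ,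
      AllPairs.map⁺ p))

    ramsey-sound : All (Any (Holds ρ)) (ramsey (length L) a)
    ramsey-sound = All.++⁺
      (All.map⁺ (All.tabulate λ {S} i → someEqual-sound ρ false S (no-triangle i)))
      (All.map⁺ (All.tabulate λ {S} i → someEqual-sound ρ true S (no-independent i)))

    search-sound : ∀ {leaf known} → Verified leaf known (length L) a → All (Holds ρ) known →
                   ∃ λ β → leaf β ≡ true × All (Holds ρ) β
    search-sound {leaf} {known} (verified e) hk =
        dpll-sound ρ leaf 500 [] (map [_] known ++ ramsey (length L) a) e []
        (All.++⁺ (All.map⁺ (All.map here hk)) ramsey-sound)

    search-refutes : ∀ {known} → Verified (λ _ → false) known (length L) a → All (Holds ρ) known → ⊥
    search-refutes v hk with () ← proj₁ (proj₂ (search-sound v hk))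

    search-copy : ∀ s {known} → Verified (hasCopy (co (shape s))) known (length L) a → All (Holds ρ) known →
                  ∃ λ f → Copy s f × (∀ i → ∃ λ n → f i ≡ nth d L n)
    search-copy s e hk with search-sound e hk
    ... | β , ok , hβ with hasCopy-sound _ β ok
    ... | f , fok = nth d L ∘ f , (λ i j → edge-sound ρ β (λ i j → h-sym _ _) (λ i → h-irrefl _) hβ (fok i j))
        , λ i → f i , refl

  -- The Ramsey graph on five vertices and R(3,4)

  twin-free : ∀ s i j → i ≡ j ⊎ ∃ λ k → co (shape s) i k ≢ co (shape s) j k
  twin-free point zero zero = inj₁ refl
  twin-free pentagon = toWitness {a? = Fin.all? λ i → Fin.all? λ j → (i Fin.≟ j) ⊎-dec Fin.any? λ k →
      ¬? (co C5 i k Bool.≟ co C5 j k)} _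
  twin-free thirteen = toWitness {a? = Fin.all? λ i → Fin.all? λ j → (i Fin.≟ j) ⊎-dec Fin.any? λ k →
      ¬? (co Q i k Bool.≟ co Q j k)} _

  -- Vertices with the same image would have the same neighbours, and the pieces have no such pairs;
  -- the search for copies can thus ignore injectivity.
  copy-injective : ∀ s {f} → Copy s f → ∀ {i j} → f i ≡ f j → i ≡ j
  copy-injective s {f} c {i} {j} e with twin-free s i j
  ... | inj₁ p = p
  ... | inj₂ (k , d) = ⊥-elim (d (trans (sym (c i k)) (trans (cong (λ v → h v (f k)) e) (c j k))))

  copy-spans : ∀ s {f W} → Copy s f → (∀ i → f i ∈ W) → length W ≡ size s → W ↭ tabulate f
  copy-spans s {f} {W} c f∈ l = ⊆⇒↭ (AllPairs.tabulate⁺ λ n e → n (copy-injective s c e))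
    (λ i → let (j , e) = ∈-tabulate⁻ {f = f} i in subst (_∈ W) (sym e) (f∈ j)) (trans (length-tabulate f) (sym l))

  -- A pattern match on this for a concrete certificate would unfold the whole search.
  search-spans : ∀ {d L W a} → d ∈ L → W ↭ L → Unique W → TriangleFree W → NoInd W a → ∀ s {known} →
      length L ≡ size s →
                 Verified (hasCopy (co (shape s))) known (length L) a → All (Holds (adjacency d L)) known →
                 ∃ λ f → Copy s f × W ↭ tabulate f
  search-spans {d} {L} d∈L σ u t n s l v hk
    with search-copy d L (Unique-resp-↭ σ u) (TriangleFree-⊆ (⊆-↭ (↭-sym σ)) t) (NoInd-⊆ (⊆-↭ (↭-sym σ)) n) s
        v hk
  ... | f , c , f∈ = f , c , ↭-trans σ (copy-spans s c (λ i → let (j , e) = f∈ i in subst (_∈ L) (sym e) (nth-∈ L d∈L id j)) l)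

  pentagon-spans : ∀ {W} → Unique W → TriangleFree W → NoInd W 2 → length W ≡ 5 →
                   ∃ λ f → Copy pentagon f × W ↭ tabulate f
  pentagon-spans {d ∷ _ ∷ _ ∷ _ ∷ _ ∷ []} u t n refl =
      search-spans {d = d} (here refl) ↭-refl u t n pentagon refl search5 []

  tight : ∀ {a b A B} → a ≤ A → b ≤ B → A + B ≤ a + b → a ≡ A × b ≡ B
  tight {a} {b} {A} {B} p q r =
    ≤-antisym p (+-cancelʳ-≤ B A a (≤-trans r (+-monoʳ-≤ a q))) ,
    ≤-antisym q (+-cancelˡ-≤ A B b (≤-trans r (+-monoˡ-≤ b p)))

  -- One better than `bound-suc` gives. Nine vertices would make the count tight, with three
  -- neighbours of `v` and a pentagon of non-neighbours, which `search9` excludes.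
  bound₃ : Bound 3 8
  bound₃ {[]} u t n = z≤n
  bound₃ {v ∷ W} u t n with suc (length W) ≤? 8 | star v W
  ... | yes p | _ = p
  ... | no p | N , M , σ , eN , eM with star-bounds u t n σ eN eM
  ... | lN , nM = ⊥-elim (go N σ eN lM≡ (proj₁ N≡3×M≡5))
    where
    σ′ : ∀ {N} → W ↭ N ++ M → v ∷ W ↭ v ∷ N ++ M
    σ′ = prep v
    uM = AllPairs-++⁻ʳ N (AllPairs.tail (Unique-resp-↭ (σ′ σ) u))
    tM : TriangleFree M
    tM = TriangleFree-⊆ (λ i → there (⊆-↭ (↭-sym σ) (∈-++⁺ʳ N i))) t
    N≡3×M≡5 : length N ≡ 3 × length M ≡ 5
    N≡3×M≡5 = tight lN (bound₂ uM tM nM)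
      (≤-trans (s≤s⁻¹ (≰⇒> p)) (≤-reflexive (trans (↭-length σ) (length-++ N))))
    lM≡ : length M ≡ 5
    lM≡ = proj₂ N≡3×M≡5
    go : ∀ N → W ↭ N ++ M → All (λ x → h v x ≡ true) N → length M ≡ 5 → length N ≡ 3 → ⊥
    go N@(n₁ ∷ n₂ ∷ n₃ ∷ []) σ (e₁ ∷ e₂ ∷ e₃ ∷ []) lM refl with pentagon-spans uM tM nM lM
    ... | f , c , τ with All-resp-↭ τ eM
    ... | f₀ ∷ f₁ ∷ f₂ ∷ f₃ ∷ f₄ ∷ [] =
      search-refutes v (v ∷ N ++ tabulate f) (Unique-resp-↭ υ u)
        (TriangleFree-⊆ (⊆-↭ (↭-sym υ)) t) (NoInd-⊆ (⊆-↭ (↭-sym υ)) n) search9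
        (e₁ ∷ e₂ ∷ e₃ ∷ f₀ ∷ f₁ ∷ f₂ ∷ f₃ ∷ f₄ ∷ c (# 0) (# 2) ∷ c (# 2) (# 4) ∷ c (# 1) (# 4) ∷ c (# 1)
            (# 3) ∷ c (# 0) (# 3) ∷ [])
      where
      υ : v ∷ W ↭ v ∷ N ++ tabulate f
      υ = prep v (↭-trans σ (++⁺ˡ N τ))

  -- Uniqueness of the Ramsey graph on thirteen vertices

  module Thirteen {W} (u : Unique W) (t : TriangleFree W) (n : NoInd W 4) (l : length W ≡ 13) where

    -- At most four neighbours and, by `bound₃`, at most eight non-neighbours: 13 = 1 + 4 + 8 leaves
    -- no slack.
    star₁₃ : ∀ {v} → v ∈ W → ∃₂ λ N M → W ↭ v ∷ N ++ M × All (λ x → h v x ≡ true) N ×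
        All (λ x → h v x ≡ false) M ×
             length N ≡ 4 × length M ≡ 8 × NoInd M 3
    star₁₃ {v} v∈ with ∈⇒↭∷ v∈
    ... | W′ , σ with star v W′
    ... | N , M , τ , eN , eM with star-bounds (Unique-resp-↭ σ u) (TriangleFree-⊆ (⊆-↭ (↭-sym σ)) t)
        (NoInd-⊆ (⊆-↭ (↭-sym σ)) n) τ eN eM
    ... | lN , nM with tight lN
        (bound₃ (AllPairs-++⁻ʳ N (AllPairs.tail (Unique-resp-↭ υ u)))
            (TriangleFree-⊆ (λ i → ⊆-↭ (↭-sym υ) (there (∈-++⁺ʳ N i))) t) nM)
        (≤-reflexive (suc-injective (trans (trans (sym l) (↭-length υ)) (cong suc (length-++ N)))))
      where
      υ : W ↭ v ∷ N ++ M
      υ = ↭-trans σ (prep v τ)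
    ... | l₁ , l₂ = N , M , ↭-trans σ (prep v τ) , eN , eM , l₁ , l₂ , nM

    meet-or-disjoint : ∀ xs ys → (∃ λ (x : V) → x ∈ xs × x ∈ ys) ⊎ (∀ {x} → x ∈ xs → x ∉ ys)
    meet-or-disjoint xs ys with Any.any? (_∈? ys) xs
    ... | yes p = inj₁ (find p)
    ... | no p = inj₂ λ i j → p (Any.map (λ { refl → j }) i)

    module _ {v N M} (σ : W ↭ v ∷ N ++ M) (eN : All (λ x → h v x ≡ true) N) (eM : All (λ x → h v x ≡ false) M)
             (lN : length N ≡ 4) (lM : length M ≡ 8) (nM : NoInd M 3) where

      v∈W : v ∈ W
      v∈W = ⊆-↭ (↭-sym σ) (here refl)
      N⊆W : N ⊆ W
      N⊆W i = ⊆-↭ (↭-sym σ) (there (∈-++⁺ˡ i))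
      M⊆W : M ⊆ W
      M⊆W i = ⊆-↭ (↭-sym σ) (there (∈-++⁺ʳ N i))
      uNM : Unique (N ++ M)
      uNM = AllPairs.tail (Unique-resp-↭ σ u)

      -- `m` has four neighbours. One is `v`, and the others avoid `N` because there are no
      -- triangles.
      second-neighbours : ∀ {m} → m ∈ N → ∃ λ A → length A ≡ 3 × Unique A × A ⊆ M × All (λ x → h m x ≡ true) A
      second-neighbours {m} m∈N with star₁₃ (N⊆W m∈N)
      ... | N′ , M′ , τ , eN′ , eM′ , lN′ , _ with ∈⇒↭∷ v∈N′
        where
        vm : h v m ≡ true
        vm = All.lookup eN m∈N
        v∈N′ : v ∈ N′
        v∈N′ = [ id , (λ i → true≢false (flip-edge vm) (All.lookup eM′ i)) ]′
            (∈-++⁻ N′ (∈-∷⁻ (⊆-↭ τ v∈W) (edge⇒≢ vm)))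
      ... | A , υ = A , suc-injective (trans (sym (↭-length υ)) lN′) , AllPairs.tail uvA , A⊆M , edges-A
        where
        uvA : Unique (v ∷ A)
        uvA = Unique-resp-↭ υ (AllPairs-++⁻ˡ N′ (AllPairs.tail (Unique-resp-↭ τ u)))
        edges-A : All (λ x → h m x ≡ true) A
        edges-A = All.tail (All-resp-↭ υ eN′)
        A⊆W : A ⊆ W
        A⊆W i = ⊆-↭ (↭-sym τ) (there (∈-++⁺ˡ (⊆-↭ (↭-sym υ) (there i))))
        A⊆M : A ⊆ M
        A⊆M i with ⊆-↭ σ (A⊆W i)
        ... | here refl = ⊥-elim (All.lookup (AllPairs.head uvA) i refl)
        ... | there j with ∈-++⁻ N j
        ... | inj₂ k = k
        ... | inj₁ k = ⊥-elim (t v∈W (N⊆W m∈N) (N⊆W k) (All.lookup eN m∈N) (All.lookup edges-A i)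
            (All.lookup eN k))

      Square : Set
      Square = ∃ λ x → ∃₂ λ a b → x ∈ M × a ∈ N × b ∈ N × a ≢ b × h a x ≡ true × h b x ≡ true

      -- Three neighbours of v have 9 second neighbours among 8 vertices.
      square : Square
      square = go N lN uNM second-neighbours id
        where
        go : ∀ N₁ → length N₁ ≡ 4 → Unique (N₁ ++ M) →
             (∀ {m} → m ∈ N₁ → ∃ λ A → length A ≡ 3 × Unique A × A ⊆ M × All (λ x → h m x ≡ true) A) →
                 N₁ ⊆ N → Square
        go (a ∷ b ∷ c ∷ d ∷ []) refl ((a≢b ∷ a≢c ∷ _) ∷ (b≢c ∷ _) ∷ _) second toN
          with second (here refl) | second (there (here refl)) | second (there (there (here refl)))
        ... | A , lA , uA , A⊆ , eA | B , lB , uB , B⊆ , eB | C , lC , uC , C⊆ , eC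
          with meet-or-disjoint A B | meet-or-disjoint A C | meet-or-disjoint B C
        ... | inj₁ (x , i , j) | _ | _ = x , a , b , A⊆ i , toN (here refl) , toN (there (here refl)) , a≢b ,
            All.lookup eA i , All.lookup eB j
        ... | _ | inj₁ (x , i , j) | _ = x , a , c , A⊆ i , toN (here refl) ,
            toN (there (there (here refl))) , a≢c , All.lookup eA i , All.lookup eC j
        ... | _ | _ | inj₁ (x , i , j) = x , b , c , B⊆ i , toN (there (here refl)) ,
            toN (there (there (here refl))) , b≢c , All.lookup eB i , All.lookup eC j
        ... | inj₂ AB | inj₂ AC | inj₂ BC =
            ⊥-elim (1+n≰n {8} (subst₂ _≤_ (trans (length-++ A)
            (cong₂ _+_ lA (trans (length-++ B) (cong₂ _+_ lB lC)))) lM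
          (⊆⇒length≤ (Uniqueₚ.++⁺ uA (Uniqueₚ.++⁺ uB uC (λ (i , j) → BC i j)) λ (i , j) → [ AB i ,
              AC i ]′ (∈-++⁻ B j))
            λ i → [ A⊆ , (λ j → [ B⊆ , C⊆ ]′ (∈-++⁻ B j)) ]′ (∈-++⁻ A i))))

      -- Next to `a` and `b`, `x` has at most two neighbours, `Y`. Its other non-neighbours `C` in
      -- `M` contain no independent triple, so there are at most five. As seven vertices of `M`
      -- remain, both counts are tight, `C` is a pentagon and the labelling of `known13` applies.
      from-square : Square → ∃ λ f → Copy thirteen f × W ↭ tabulate f
      from-square (x , a , b , x∈M , a∈N , b∈N , a≢b , ax , bx)
        with ⊆⇒↭++ {xs = a ∷ b ∷ []} ((a≢b ∷ []) ∷ [] ∷ [])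
            (λ { (here refl) → a∈N ; (there (here refl)) → b∈N }) | ∈⇒↭∷ x∈M
      ... | N′ , τ | M′ , υ with star x M′
      ... | Y , C , φ , eY , eC = go N′ Y τ φ eY
          (suc-injective (suc-injective (trans (sym (↭-length τ)) lN))) (proj₁ Y≡2×C≡5)
        where
        uM : Unique (x ∷ M′)
        uM = Unique-resp-↭ υ (AllPairs-++⁻ʳ N uNM)
        uYC : Unique (Y ++ C)
        uYC = Unique-resp-↭ φ (AllPairs.tail uM)
        YC⊆M : Y ++ C ⊆ M
        YC⊆M i = ⊆-↭ (↭-sym υ) (there (⊆-↭ (↭-sym φ) i))
        C⊆M : C ⊆ M
        C⊆M i = YC⊆M (∈-++⁺ʳ Y i)
        x∉C : x ∉ C
        x∉C i = All.lookup (AllPairs.head uM) (⊆-↭ (↭-sym φ) (∈-++⁺ʳ Y i)) refl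
        nC : NoInd C 2
        nC = NoInd-nonneighbours nM x∈M x∉C C⊆M eC
        tC : TriangleFree C
        tC = TriangleFree-⊆ (M⊆W ∘ C⊆M) t
        uC : Unique C
        uC = AllPairs-++⁻ʳ Y uYC
        N∌M : ∀ {z} → z ∈ N → z ∉ M
        N∌M = Unique-++-disjoint N uNM
        lY : length Y ≤ 2
        lY = s≤s⁻¹ (s≤s⁻¹ (neighbours≤ t n (M⊆W x∈M)
          (λ { (here refl) → N⊆W a∈N ; (there (here refl)) → N⊆W b∈N ; (there (there i)) →
              M⊆W (YC⊆M (∈-++⁺ˡ i)) })
          ((a≢b ∷ ∉⇒All≢ (N∌M a∈N ∘ YC⊆M ∘ ∈-++⁺ˡ)) ∷ ∉⇒All≢ (N∌M b∈N ∘ YC⊆M ∘ ∈-++⁺ˡ) ∷ AllPairs-++⁻ˡ Y uYC)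
          (flip-edge ax ∷ flip-edge bx ∷ eY)))
        Y≡2×C≡5 : length Y ≡ 2 × length C ≡ 5
        Y≡2×C≡5 = tight lY (bound₂ uC tC nC)
          (≤-reflexive (suc-injective (trans (trans (sym lM) (↭-length υ))
              (cong suc (trans (↭-length φ) (length-++ Y))))))
        go : ∀ N′ Y → N ↭ a ∷ b ∷ N′ → M′ ↭ Y ++ C → All (λ z → h x z ≡ true) Y → length N′ ≡ 2 → length Y ≡ 2 →
             ∃ λ f → Copy thirteen f × W ↭ tabulate f
        go N′@(c ∷ d ∷ []) Y@(y ∷ z ∷ []) τ φ (xy ∷ xz ∷ []) refl refl with pentagon-spans uC tC nC
            (proj₂ Y≡2×C≡5)
        ... | p , cp , ψ with All-resp-↭ (↭-trans υ (prep x (↭-trans φ (++⁺ˡ Y ψ)))) eM | All-resp-↭ τ eN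
            | All-resp-↭ ψ eC
        ... | vx ∷ vy ∷ vz ∷ v₀ ∷ v₁ ∷ v₂ ∷ v₃ ∷ v₄ ∷ [] | va ∷ vb ∷ vc ∷ vd ∷ [] | x₀ ∷ x₁ ∷ x₂ ∷ x₃ ∷ x₄ ∷ []
          = search-spans {d = v} (here refl) ω u t n thirteen refl search13
              (va ∷ vb ∷ vc ∷ vd ∷ vx ∷ vy ∷ vz ∷ v₀ ∷ v₁ ∷ v₂ ∷ v₃ ∷ v₄ ∷ ax ∷ bx ∷ xy ∷ xz ∷
               x₀ ∷ x₁ ∷ x₂ ∷ x₃ ∷ x₄ ∷ cp (# 0) (# 2) ∷ cp (# 2) (# 4) ∷ cp (# 1) (# 4) ∷
               cp (# 1) (# 3) ∷ cp (# 0) (# 3) ∷ [])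
          where
          L = v ∷ a ∷ b ∷ N′ ++ x ∷ Y ++ tabulate p
          ω : W ↭ L
          ω = ↭-trans σ (prep v (++⁺ τ (↭-trans υ (prep x (↭-trans φ (++⁺ˡ Y ψ))))))

    thirteen-spans : ∃ λ f → Copy thirteen f × W ↭ tabulate f
    thirteen-spans = go W l id
      where
      go : ∀ U → length U ≡ 13 → U ⊆ W → ∃ λ f → Copy thirteen f × W ↭ tabulate f
      go (v ∷ U) _ U⊆W with star₁₃ (U⊆W (here refl))
      ... | N , M , σ , eN , eM , lN , lM , nM = from-square σ eN eM lN lM nM (square σ eN eM lN lM nM)

  -- Sets with a given gap

  Outcome : ℕ → List V → Set
  Outcome g W = Better g W ⊎ Decomp g W

  better-↭ : ∀ g {U W} → U ↭ W → Better g U → Better g W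
  better-↭ g σ (k , c , l) = k , cov-↭ σ c , subst (_ ≤_) (↭-length σ) l

  outcome-↭ : ∀ {g U W} → U ↭ W → Outcome g U → Outcome g W
  outcome-↭ {g} σ = [ inj₁ ∘ better-↭ g σ , inj₂ ∘ decomp-↭ σ ]′

  -- A vertex isolated from a decomposition is a new point. One with a neighbour there is covered
  -- for free, and the order has grown, so the cover is better.
  outcome-∷ : ∀ {g U} v → Outcome g U → Outcome g (v ∷ U)
  outcome-∷ v (inj₁ (k , c , l)) = inj₁ (suc k , cov-∷ (clique-1 v) c , s≤s l)
  outcome-∷ {U = U} v (inj₂ D) with Any.any? (λ y → h v y Bool.≟ true) U
  ... | yes p = let (w , w∈ , e) = find p ; (k , c , l) = decomp-augment D w∈ e in inj₁ (k , c , s≤s (≤-reflexive l))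
  ... | no p = inj₂ (decomp-point v D λ {y} i → [ (λ e → ⊥-elim (p (Any.map (λ { refl → e }) i))) ,
      id ]′ (edge-or-not v y))

  outcome₀ : ∀ W → Outcome 0 W
  outcome₀ [] = inj₂ nil
  outcome₀ (x ∷ W) = outcome-∷ x (outcome₀ W)

  outcome-cov : ∀ {g W} → Outcome g W → ∃ λ k → Cov W k × k + (g + g) ≤ length W
  outcome-cov (inj₁ (k , c , l)) = k , c , ≤-trans (n≤1+n _) l
  outcome-cov (inj₂ D) = let (k , c , l) = decomp-cov D in k , c , ≤-reflexive l

  interchange : ∀ k l a b → (k + l) + ((a + b) + (a + b)) ≡ (k + (a + a)) + (l + (b + b))
  interchange = solve-∀

  outcome-++ : ∀ {a b X Y} → NoEdges X Y → Outcome a X → Outcome b Y → Outcome (a + b) (X ++ Y)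
  outcome-++ n (inj₂ D) (inj₂ E) = inj₂ (decomp-++ D E n)
  outcome-++ {a} {b} {X} n (inj₁ (k , c , l)) o = let (k′ , c′ , l′) = outcome-cov o in
    inj₁ (k + k′ , cov-++ c c′ , ≤-trans (≤-reflexive (cong suc (interchange k k′ a b)))
      (≤-trans (+-mono-≤ l l′) (≤-reflexive (sym (length-++ X)))))
  outcome-++ {a} {b} {X} n o@(inj₂ _) (inj₁ (k′ , c′ , l′)) = let (k , c , l) = outcome-cov o in
    inj₁ (k + k′ , cov-++ c c′ , ≤-trans
        (≤-reflexive (trans (cong suc (interchange k k′ a b)) (sym (+-suc _ _))))
      (≤-trans (+-mono-≤ l l′) (≤-reflexive (sym (length-++ X)))))

  gap-suc : ∀ k g → 1 + (k + ((1 + g) + (1 + g))) ≡ 3 + (k + (g + g))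
  gap-suc = solve-∀

  three-gaps : ∀ m g → m + (g + g + g) ≡ (m + g) + (g + g)
  three-gaps = solve-∀

  -- A vertex of the triangle absorbed by no piece enlarges a maximum independent set; if all are absorbed,
  -- the triangle costs no clique at all.
  triangle-suc : ∀ {g U x y z} → Unique U → g ≤ 2 → Clique (x ∷ y ∷ z ∷ []) →
      (∀ {t} → t ∈ x ∷ y ∷ z ∷ [] → t ∉ U) →
                 Gap (suc g) (x ∷ y ∷ z ∷ U) → Outcome g U → Better (suc g) (x ∷ y ∷ z ∷ U)
  triangle-suc {g} u g≤2 cT T∉ G (inj₁ (k , c , l)) =
    suc k , cov-∷ cT c , ≤-trans (≤-reflexive (cong suc (gap-suc k g))) (s≤s (s≤s (s≤s l)))
  triangle-suc {g} {U} {x} {y} {z} u g≤2 cT T∉ G (inj₂ D)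
    with absorbed (here refl) | absorbed (there (here refl)) | absorbed (there (there (here refl)))
    where
    absorbed : ∀ {t} → t ∈ x ∷ y ∷ z ∷ [] → Absorbed t D
    absorbed {t} t∈ with absorbed-or-avoids-all t D u g≤2
    ... | inj₁ a = a
    -- The counts for `D` give k = m + g. The triangle adds one clique and `t` one independent
    -- vertex, so the gap would still be at most `g`, against `G`.
    ... | inj₂ (m , (I , avoids) , e) =
        ⊥-elim (1+n≰n (≤-trans (≤-trans (≤-reflexive (eq e)) (s≤s⁻¹ bound)) ≤-refl))
      where
      k = proj₁ (decomp-cov D)
      c = proj₁ (proj₂ (decomp-cov D))
      t∈W : ∀ {s} → s ∈ x ∷ y ∷ z ∷ [] → s ∈ x ∷ y ∷ z ∷ U
      t∈W = ∈-++⁺ˡ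
      bound : suc m + suc g ≤ suc k
      bound = G (cov-∷ cT c) (ind-⊆ (λ { (here refl) → t∈W t∈ ; (there i) → there (there (there i)) })
                               (ind-∷ I (T∉ t∈ ∘ proj₁ (proj₂ (proj₂ I))) avoids))
      eq : m + (g + g + g) ≡ length U → suc k ≡ m + suc g
      eq e = trans (cong suc (+-cancelʳ-≡ (g + g) k (m + g)
          (trans (proj₂ (proj₂ (decomp-cov D))) (trans (sym e) (three-gaps m g))))) (sym (+-suc m g))
  ... | a | b | c with absorb D cT (a ∷ b ∷ c ∷ [])
  ... | k , cov , e = k , cov , ≤-reflexive (trans (gap-suc k g) (cong (3 +_) e))

  ¬gap : ∀ {g W} → ¬ Gap g W → ¬ ¬ (∃₂ λ k m → Cov W k × Ind W m × k < m + g)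
  ¬gap ¬G f = ¬G λ {k} {m} c i → ≮⇒≥ λ l → f (k , m , c , i , l)

  -- Raises `a` as long as `X` has the larger gap. At the first failure some cover and independent
  -- set of `X` differ by at most `a`; combined with those of `Y` they leave the gap `b` to `Y`. The
  -- alternative `a ≡ 0` stands in for gap 0.
  gap-split : ∀ {X Y} g → NoEdges X Y → (∀ {x} → x ∈ X → x ∉ Y) → Gap g (X ++ Y) → ∀ a b → a + b ≡ g →
              a ≡ 0 ⊎ Gap a X →
              ¬ ¬ (∃₂ λ a b → a + b ≡ g × (a ≡ 0 ⊎ Gap a X) × (b ≡ 0 ⊎ Gap b Y))
  gap-split g n d G a zero e ga = return (a , 0 , e , ga , inj₁ refl)
  gap-split {X} g n d G a (suc b) e ga = em⊎ {Gap (suc a) X} >>= λ where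
      (inj₁ ga′) → gap-split g n d G (suc a) b (trans (sym (+-suc a b)) e) (inj₂ ga′)
      (inj₂ ¬ga) → do
        k , m , c , i , l ← ¬gap ¬ga
        return (a , suc b , e , ga , inj₂ λ {k′} {m′} c′ i′ →
          +-cancelˡ-≤ (m + a) (m′ + suc b) k′ (≤-trans (≤-reflexive (lemma m a m′ b e))
            (≤-trans (G (cov-++ c c′) (ind-++ n d i i′))
                (+-monoˡ-≤ k′ (s≤s⁻¹ (subst (suc k ≤_) (+-suc m a) l))))))
    where
    lemma : ∀ m a m′ b → a + suc b ≡ g → (m + a) + (m′ + suc b) ≡ (m + m′) + g
    lemma m a m′ b refl = lemma′ m a m′ b
      where
      lemma′ : ∀ m a m′ b → (m + a) + (m′ + suc b) ≡ (m + m′) + (a + suc b)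
      lemma′ = solve-∀

  -- A single Gallai class

  module OneClass {X v k g} (u : Unique X) (t : TriangleFree X) (v∈X : v ∈ X) (c : Cov X k)
      (2k : k + k ≤ suc (length X))
                  (G : Gap g X) (¬b : ¬ Better g X) where

    -- Since the cover is not better, the order is at most k + 2g; doubling this and inserting `2k`
    -- gives 4g + 1.
    length≤ : length X ≤ suc ((g + g) + (g + g))
    length≤ = +-cancelˡ-≤ (length X) _ _ (≤-trans (+-mono-≤ short short)
      (≤-trans (≤-reflexive (lemma k (g + g)))
          (≤-trans (+-monoˡ-≤ _ 2k) (≤-reflexive (sym (+-suc (length X) _))))))
      where
      short : length X ≤ k + (g + g)
      short = ≮⇒≥ λ l → ¬b (k , c , l)
      lemma : ∀ k a → (k + a) + (k + a) ≡ (k + k) + (a + a)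
      lemma = solve-∀

    -- An independent set of size m satisfies 2(m + g) ≤ 2k ≤ b + 1, which fails once m exceeds `a`.
    noInd : ∀ a b → length X ≤ b → suc (suc b) ≤ (suc a + suc a) + (g + g) → NoInd X a
    noInd a b l q {m} i = ≮⇒≥ λ a<m → 1+n≰n (≤-trans q (≤-trans (+-monoˡ-≤ (g + g) (+-mono-≤ a<m a<m))
      (≤-trans (≤-reflexive (lemma m g)) (≤-trans (+-mono-≤ (G c i) (G c i)) (≤-trans 2k (s≤s l))))))
      where
      lemma : ∀ m g → (m + m) + (g + g) ≡ (m + g) + (m + g)
      lemma = solve-∀

    nonempty : ¬ NoInd X 0
    nonempty n = 1+n≰n (≤-trans (∈-length v∈X) (bound₀ u t n))

    refine₁ : ∀ b → length X ≤ b → suc (suc b) ≤ 4 + (g + g) → 3 < 2 + (g + g) → ⊥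
    refine₁ b l q r = nonempty (noInd 0 2 (bound₁ u t (noInd 1 b l q)) r)

  single : ∀ s {X f} → Copy s f → X ↭ tabulate f → Decomp (gapOf s) X
  single s {f = f} c σ = cons s f c nil (λ _ ()) (↭-trans σ (↭-reflexive (sym (++-identityʳ (tabulate f)))))
      (sym (+-identityʳ _))

  -- `noInd` turns a bound on the order into one on independent sets, and the Ramsey bounds turn
  -- that into a smaller order, until `X` would be empty. The descent stops only at order 5 for gap
  -- 1 and order 13 for gap 3; for gap 2 it runs through 9, 8, 5 and 2.
  one-class : ∀ g {X v k} → g ≤ 2 → Unique X → TriangleFree X → v ∈ X → Cov X k → k + k ≤ suc (length X) →
              Gap (suc g) X → ¬ Better (suc g) X → Decomp (suc g) X
  one-class 0 {X} _ u t v∈ c 2k G ¬b with m≤n⇒m<n∨m≡n (OneClass.length≤ u t v∈ c 2k G ¬b)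
  ... | inj₂ l = let (f , c′ , σ) = pentagon-spans u t (OneClass.noInd u t v∈ c 2k G ¬b 2 5 (≤-reflexive l) (≤ᵇ⇒≤ _ _ tt)) l in single pentagon c′ σ
  ... | inj₁ l = ⊥-elim (OneClass.refine₁ u t v∈ c 2k G ¬b 4 (s≤s⁻¹ l) (≤ᵇ⇒≤ _ _ tt) (≤ᵇ⇒≤ _ _ tt))
  one-class 1 _ u t v∈ c 2k G ¬b =
      ⊥-elim (refine₁ 5 (bound₂ u t (noInd 2 8 (bound₃ u t (noInd 3 9 length≤ (≤ᵇ⇒≤ _ _ tt))) (≤ᵇ⇒≤ _ _ tt)))
      (≤ᵇ⇒≤ _ _ tt) (≤ᵇ⇒≤ _ _ tt))
    where open OneClass u t v∈ c 2k G ¬b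
  one-class 2 {X} _ u t v∈ c 2k G ¬b with m≤n⇒m<n∨m≡n (OneClass.length≤ u t v∈ c 2k G ¬b)
  ... | inj₂ l = let (f , c′ , σ) = Thirteen.thirteen-spans u t (OneClass.noInd u t v∈ c 2k G ¬b 4 13 (≤-reflexive l) (≤ᵇ⇒≤ _ _ tt)) l in single thirteen c′ σ
  ... | inj₁ l = ⊥-elim (refine₁ 8 (bound₃ u t (noInd 3 12 (s≤s⁻¹ l) (≤ᵇ⇒≤ _ _ tt))) (≤ᵇ⇒≤ _ _ tt)
      (≤ᵇ⇒≤ _ _ tt))
    where open OneClass u t v∈ c 2k G ¬b
  one-class (suc (suc (suc _))) (s≤s (s≤s ()))

  -- Critical sets and their Gallai classes

  Critical : ℕ → List V → Set
  Critical g W = ∀ {v U} → W ↭ v ∷ U → ¬ Gap g U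

  -- Without `v` there are a cover by k cliques and an independent set of size m with k < m + g. The
  -- cover yields a matching missing `v`. Any matching of `W` yields a cover of `W`, which by the
  -- gap has more than k cliques, so it misses no fewer vertices.
  critical-matching : ∀ {g W} → Unique W → TriangleFree W → Gap g W → Critical g W →
                      ∀ {v} → v ∈ W → ¬ ¬ (∃ λ (M : Matching W) → partner M v ≡ v × Optimal M)
  critical-matching {g} {W} u t G crit {v} v∈ with ∈⇒↭∷ v∈
  ... | U , σ = do
    k , m , (L , l , cL , cov) , i , k<m+g ← ¬gap (crit σ)
    let uvU = Unique-resp-↭ σ u
        U⊆W : U ⊆ W
        U⊆W i = ⊆-↭ (↭-sym σ) (there i)
        (M , small) = cov⇒matching L (AllPairs.tail uvU) (TriangleFree-⊆ U⊆W t) cL cov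
    return (matching-⊆ U⊆W M , decidable-stable (partner M v ≟ v)
        (λ n → All.lookup (AllPairs.head uvU) (inside M n) refl) ,
      λ N → let (k′ , c′ , 2k′) = closed⇒cov _ (partner N) W ≤-refl (involutive N) (edges N) u (partner∈ N)
                k<k′ = ≤-trans k<m+g (G c′ (ind-⊆ U⊆W i))
            in +-cancelˡ-≤ (length W) _ _ (begin
              length W + length (fixed (partner M) W) ≤⟨ +-mono-≤ (≤-reflexive (↭-length σ)) (missed≤ M) ⟩
              suc (length U) + suc (length (fixed (partner M) U)) ≡⟨ cong suc (+-suc _ _) ⟩
              2 + (length U + length (fixed (partner M) U)) ≤⟨ +-monoʳ-≤ 2 (≤-trans small (+-mono-≤ l l)) ⟩
              2 + (k + k) ≡⟨ cong suc (sym (+-suc k k)) ⟩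
              suc k + suc k ≤⟨ +-mono-≤ k<k′ k<k′ ⟩
              k′ + k′ ≤⟨ 2k′ ⟩
              length W + length (missed N) ∎))
    where
    open ≤-Reasoning
    missed≤ : ∀ (M : Matching U) → length (fixed (partner M) W) ≤ suc (length (fixed (partner M) U))
    missed≤ M = ≤-trans (fixed-⊆ {q = partner M} u (λ i e → ⊆-↭ σ i , e)) (fixed-∷ (partner M))

  -- The class of v is covered by an optimal matching missing v, which misses no other vertex of the class.
  gallai-class : ∀ {g W v} → Unique W → TriangleFree W → Gap g W → Critical g W → v ∈ W →
    ¬ ¬ (∃₂ λ X Y → W ↭ X ++ Y × v ∈ X × NoEdges X Y × ∃ λ k → Cov X k × k + k ≤ suc (length X))
  gallai-class {g} {W} {v} u t G crit v∈ = do
    linked? ← ¬¬-shift {P = λ x → Linked v x ⊎ ¬ Linked v x} W (λ _ → em⊎)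
    let (X , Y , σ , lX , lY) = partition-↭ W linked?
        v∈X : v ∈ X
        v∈X = [ id , (λ i → ⊥-elim (All.lookup lY i λ _ _ _ _ → refl)) ]′ (∈-++⁻ X (⊆-↭ σ v∈))
        X⊆W : X ⊆ W
        X⊆W i = ⊆-↭ (↭-sym σ) (∈-++⁺ˡ i)
        Y⊆W : Y ⊆ W
        Y⊆W i = ⊆-↭ (↭-sym σ) (∈-++⁺ʳ X i)
        separated : NoEdges X Y
        separated {x} {y} i j = [ (λ e → ⊥-elim (All.lookup lY j
          (linked-trans v∈ (X⊆W i) (Y⊆W j) (All.lookup lX i) (edge⇒linked (X⊆W i) (Y⊆W j) e)))) ,
              id ]′ (edge-or-not x y)
    M , Mv , oM ← critical-matching u t G crit v∈
    -- No edge leaves the class, so `M` restricts to it.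
    let closed : ∀ {x} → x ∈ X → partner M x ∈ X
        closed {x} i = [ (λ e → subst (_∈ X) (sym e) i) ,
          (λ e → [ id , (λ j → true≢false e (separated i j)) ]′ (∈-++⁻ X (⊆-↭ σ (partner∈ M (X⊆W i))))) ]′
              (edges M x)
        uX = AllPairs-++⁻ˡ X (Unique-resp-↭ σ u)
        (k , c , 2k) = closed⇒cov _ (partner M) X ≤-refl (involutive M) (edges M) uX closed
        fewMissed : length (fixed (partner M) X) ≤ 1
        fewMissed = ⊆⇒length≤ {ys = v ∷ []} (Unique-fixed _ uX) λ i →
          let (x∈ , Mx) = ∈-fixed⁻ (partner M) X i in here (sym (All.lookup lX x∈ M oM Mv Mx))
    return (X , Y , σ , v∈X , (λ {x} {y} → separated {x} {y}) , k , c ,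
      ≤-trans 2k (≤-trans (+-monoʳ-≤ (length X) fewMissed) (≤-reflexive (+-comm (length X) 1))))
    where open Gallai u (critical-matching u t G crit)

  -- The induction on the order

  Triangle : List V → Set
  Triangle W = ∃ λ x → ∃₂ λ y z → x ∈ W × y ∈ W × z ∈ W × h x y ≡ true × h y z ≡ true × h x z ≡ true

  outcome : ∀ n {W} → length W ≤ n → Unique W → ∀ {g} → g ≤ 3 → Gap g W → ¬ ¬ Outcome g W
  outcome n {W} l u {zero} g≤3 G = return (outcome₀ W)
  outcome n {[]} l u {suc g} g≤3 G with () ← G cov-[] ind-[]
  outcome (suc n) {W@(v ∷ V′)} l u {suc g} g≤3 G = em⊎ {∃₂ λ w U → W ↭ w ∷ U × Gap (suc g) U} >>= λ where
      (inj₁ (w , U , σ , G′)) → do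
        o ← outcome n (s≤s⁻¹ (subst (_≤ suc n) (↭-length σ) l)) (AllPairs.tail (Unique-resp-↭ σ u)) g≤3 G′
        return (outcome-↭ {suc g} (↭-sym σ) (outcome-∷ {suc g} w o))
      (inj₂ crit) → em⊎ {Triangle W} >>= λ where
        (inj₁ Δ) → triangle Δ
        (inj₂ noΔ) → triangle-free (λ i j k a b c → noΔ (_ , _ , _ , i , j , k , a , b , c)) λ σ G′ →
            crit (_ , _ , σ , G′)
    where
    triangle : Triangle W → ¬ ¬ Outcome (suc g) W
    triangle (x , y , z , x∈ , y∈ , z∈ , xy , yz , xz)
      with ⊆⇒↭++ {xs = x ∷ y ∷ z ∷ []} ((edge⇒≢ xy ∷ edge⇒≢ xz ∷ []) ∷ (edge⇒≢ yz ∷ []) ∷ [] ∷ [])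
             (λ { (here refl) → x∈ ; (there (here refl)) → y∈ ; (there (there (here refl))) → z∈ })
    ... | U , σ = do
      -- The triangle is a single clique, so deleting it lowers the gap by at most one.
      o ← outcome n (≤-trans (≤-trans (n≤1+n _) (n≤1+n _)) (s≤s⁻¹ (subst (_≤ suc n) (↭-length σ) l))) uU (≤-trans (n≤1+n _) g≤3)
            λ {k} {m} c i → s≤s⁻¹ (subst (_≤ suc k) (+-suc m g)
                (G (cov-↭ (↭-sym σ) (cov-∷ cT c)) (ind-⊆ (⊆-↭ (↭-sym σ) ∘ there ∘ there ∘ there) i)))
      return (inj₁ (better-↭ (suc g) (↭-sym σ)
          (triangle-suc uU (s≤s⁻¹ g≤3) cT (Unique-++-disjoint (x ∷ y ∷ z ∷ []) (Unique-resp-↭ σ u))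
          (gap-↭ σ G) o)))
      where
      cT : Clique (x ∷ y ∷ z ∷ [])
      cT = clique-∷ (λ { (here refl) → inj₂ xy ; (there (here refl)) → inj₂ xz }) (clique-2 yz)
      uU : Unique U
      uU = AllPairs-++⁻ʳ (x ∷ y ∷ z ∷ []) (Unique-resp-↭ σ u)

    smaller : ∀ {a} X → length X < length W → Unique X → a ≤ 3 → a ≡ 0 ⊎ Gap a X → ¬ ¬ Outcome a X
    smaller X _ _ _ (inj₁ refl) = return (outcome₀ X)
    smaller X l′ u a≤3 (inj₂ G) = outcome n (s≤s⁻¹ (≤-trans l′ l)) u a≤3 G

    triangle-free : TriangleFree W → Critical (suc g) W → ¬ ¬ Outcome (suc g) W
    triangle-free t crit = gallai-class u t G crit (here refl) >>= split
      where
      split : (∃₂ λ X Y → W ↭ X ++ Y × v ∈ X × NoEdges X Y × ∃ λ k → Cov X k × k + k ≤ suc (length X)) →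
          ¬ ¬ Outcome (suc g) W
      split (X , [] , σ , v∈X , n , k , c , 2k) = em⊎ {Better (suc g) W} >>= λ where
          (inj₁ b) → return (inj₁ b)
          (inj₂ ¬b) → return (inj₂ (decomp-↭ (↭-sym τ) (one-class g (s≤s⁻¹ g≤3) (Unique-resp-↭ τ u)
            (TriangleFree-⊆ (⊆-↭ (↭-sym τ)) t) v∈X c 2k (gap-↭ τ G) (¬b ∘ better-↭ (suc g) (↭-sym τ)))))
        where
        τ : W ↭ X
        τ = ↭-trans σ (↭-reflexive (++-identityʳ X))
      split (X , Y@(_ ∷ _) , σ , v∈X , n , _) = do
        a , b , e , ga , gb ← gap-split {X} {Y} (suc g) n (Unique-++-disjoint X uXY) (gap-↭ σ G) 0 (suc g) refl (inj₁ refl)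
        oX ← smaller X (subst (length X <_) lXY (m<m+n (length X) (s≤s z≤n))) (AllPairs-++⁻ˡ X uXY) (≤-trans (subst (a ≤_) e (m≤m+n a b)) g≤3) ga
        oY ← smaller Y (subst (length Y <_) lXY (m<n+m (length Y) (∈-length v∈X))) (AllPairs-++⁻ʳ X uXY) (≤-trans (subst (b ≤_) e (m≤n+m b a)) g≤3) gb
        return (outcome-↭ {suc g} (↭-sym σ) (subst (λ g → Outcome g (X ++ Y)) e (outcome-++ n oX oY)))
        where
        uXY = Unique-resp-↭ σ u
        lXY : length X + length Y ≡ length W
        lXY = sym (trans (↭-length σ) (length-++ X))

-- Back from the complement to the graph

co-≢ : ∀ {m} (P : Graph m) {x y} → x ≢ y → co P x y ≡ not (adj P x y)
co-≢ P {x} {y} x≢y with x Fin.≟ y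
... | yes e = ⊥-elim (x≢y e)
... | no _ = ∧-identityʳ _

module _ {n : ℕ} (G : Graph n) where

  co-sym : ∀ x y → co G x y ≡ co G y x
  co-sym x y = cong₂ (λ a b → not a ∧ not b) (adj-sym G x y) (does-sym x y)
    where
    does-sym : ∀ (x y : Fin n) → does (x Fin.≟ y) ≡ does (y Fin.≟ x)
    does-sym x y with x Fin.≟ y | y Fin.≟ x
    ... | yes _ | yes _ = refl
    ... | no _ | no _ = refl
    ... | yes p | no q = ⊥-elim (q (sym p))
    ... | no p | yes q = ⊥-elim (p (sym q))

  co-irrefl : ∀ x → co G x x ≡ false
  co-irrefl x with adj G x x | x Fin.≟ x
  ... | _ | no n = ⊥-elim (n refl)
  ... | true | yes _ = refl
  ... | false | yes _ = refl

  open Complement Fin._≟_ (co G) co-sym co-irrefl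

  co-true : ∀ {x y} → co G x y ≡ true → adj G x y ≡ false
  co-true {x} {y} e with adj G x y
  ... | false = refl

  co-false : ∀ {x y} → x ≢ y → co G x y ≡ false → adj G x y ≡ true
  co-false x≢y e = not-injective (trans (sym (co-≢ G x≢y)) e)

  -- A vertex is coloured by the position of a clique that covers it; cliques of the complement are
  -- independent in `G`.
  cov⇒colourable : ∀ {k} → Cov (allFin n) k → Colourable G k
  cov⇒colourable {k} (L , l , cL , cov) = colour , proper
    where
    colour : Fin n → Fin k
    colour x = Fin.inject≤ (Any.index (cov (∈-allFin x))) l
    proper : IsColouring G k colour
    proper i j ij e with All.lookup cL (∈-lookup (Any.index (cov (∈-allFin i)))) i j
      (AnyP.lookup-index (cov (∈-allFin i)))
      (subst (λ m → j ∈ lookup L m) (sym (Fin.inject≤-injective l l _ _ e))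
          (AnyP.lookup-index (cov (∈-allFin j))))
    ... | inj₁ refl = true≢false ij (adj-irrefl G i)
    ... | inj₂ h = true≢false ij (co-true h)

  subset : List (Fin n) → Subset n
  subset [] = ∅
  subset (x ∷ xs) = subset xs Vec.[ x ]≔ true

  ∈-subset⁻ : ∀ xs {y} → y Subset.∈ subset xs → y ∈ xs
  ∈-subset⁻ [] i = ⊥-elim (∉⊥ i)
  ∈-subset⁻ (x ∷ xs) {y} i with y Fin.≟ x
  ... | yes e = here e
  ... | no y≢x = there (∈-subset⁻ xs (Vec.lookup⇒[]= y (subset xs)
    (trans (sym (Vec.lookup∘update′ y≢x (subset xs) true)) (Vec.[]=⇒lookup i))))

  ∣update∣ : ∀ {m} (S : Subset m) x → Vec.lookup S x ≡ false → Subset.∣ S Vec.[ x ]≔ true ∣ ≡ suc Subset.∣ S ∣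
  ∣update∣ (false Vec.∷ S) zero e = refl
  ∣update∣ (true Vec.∷ S) (suc x) e = cong suc (∣update∣ S x e)
  ∣update∣ (false Vec.∷ S) (suc x) e = ∣update∣ S x e

  ∣subset∣ : ∀ {xs} → Unique xs → Subset.∣ subset xs ∣ ≡ length xs
  ∣subset∣ {[]} _ = ∣⊥∣≡0 n
  ∣subset∣ {x ∷ xs} (x∉ ∷ u) = trans (∣update∣ (subset xs) x (absent (Vec.lookup (subset xs) x) refl))
      (cong suc (∣subset∣ u))
    where
    absent : ∀ b → Vec.lookup (subset xs) x ≡ b → Vec.lookup (subset xs) x ≡ false
    absent false e = e
    absent true e = ⊥-elim (All.lookup x∉ (∈-subset⁻ xs (Vec.lookup⇒[]= x (subset xs) e)) refl)

  ind⇒clique : ∀ {m} → Ind (allFin n) m → ∃ λ S → IsClique G S × Subset.∣ S ∣ ≡ m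
  ind⇒clique (I , l , _ , u , a) = subset I , clique , trans (∣subset∣ u) l
    where
    clique : IsClique G (subset I)
    clique i j i∈ j∈ i≢j with ∈-AllPairs₂ a (∈-subset⁻ I i∈) (∈-subset⁻ I j∈)
    ... | inj₁ e = ⊥-elim (i≢j e)
    ... | inj₂ (inj₁ e) = co-false i≢j e
    ... | inj₂ (inj₂ e) = co-false i≢j (flip-edge e)

  -- Decompositions as joins

  IsEmbedding : ∀ {m} → Graph m → (Fin m → Fin n) → Set
  IsEmbedding H f = (∀ i j → adj G (f i) (f j) ≡ adj H i j) × (∀ i j → f i ≡ f j → i ≡ j)

  -- Counting makes the embedding onto `U`.
  Spans : ∀ {m} → Graph m → List (Fin n) → Set
  Spans {m} H U = ∃ λ f → IsEmbedding H f × (∀ i → f i ∈ U) × m ≡ length U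

  spans-⊕ : ∀ {a b} {A : Graph a} {B : Graph b} {U W} → NoEdges U W → (∀ {x} → x ∈ U → x ∉ W) →
            Spans A U → Spans B W → Spans (A ⊕ B) (U ++ W)
  spans-⊕ {a} {b} {A} {B} {U} n d (f , (pf , jf) , f∈ , lf) (g , (pg , jg) , g∈ , lg) =
    (λ i → [ f , g ]′ (splitAt a i)) , (pres , inj) , mem , trans (cong₂ _+_ lf lg) (sym (length-++ U))
    where
    cross : ∀ x y → adj G (f x) (g y) ≡ true
    cross x y = co-false (λ e → d (f∈ x) (subst (_∈ _) (sym e) (g∈ y))) (n (f∈ x) (g∈ y))
    pres : ∀ i j → adj G ([ f , g ]′ (splitAt a i)) ([ f , g ]′ (splitAt a j)) ≡ joinAdj A B i j
    pres i j with splitAt a i | splitAt a j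
    ... | inj₁ x | inj₁ y = pf x y
    ... | inj₂ x | inj₂ y = pg x y
    ... | inj₁ x | inj₂ y = cross x y
    ... | inj₂ x | inj₁ y = trans (adj-sym G _ _) (cross y x)
    inj : ∀ i j → [ f , g ]′ (splitAt a i) ≡ [ f , g ]′ (splitAt a j) → i ≡ j
    inj i j e with splitAt a i in p | splitAt a j in q
    ... | inj₁ x | inj₁ y = trans (sym (Fin.splitAt⁻¹-↑ˡ p))
        (trans (cong (_↑ˡ b) (jf x y e)) (Fin.splitAt⁻¹-↑ˡ q))
    ... | inj₂ x | inj₂ y = trans (sym (Fin.splitAt⁻¹-↑ʳ p))
        (trans (cong (a ↑ʳ_) (jg x y e)) (Fin.splitAt⁻¹-↑ʳ q))
    ... | inj₁ x | inj₂ y = ⊥-elim (d (f∈ x) (subst (_∈ _) (sym e) (g∈ y)))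
    ... | inj₂ x | inj₁ y = ⊥-elim (d (f∈ y) (subst (_∈ _) e (g∈ x)))
    mem : ∀ i → [ f , g ]′ (splitAt a i) ∈ U ++ _
    mem i with splitAt a i
    ... | inj₁ x = ∈-++⁺ˡ (f∈ x)
    ... | inj₂ y = ∈-++⁺ʳ U (g∈ y)

  spans-copy : ∀ s {f} → Copy s f → Unique (tabulate f) → Spans (shape s) (tabulate f)
  spans-copy s {f} c u = f , (pres , λ _ _ → tabulate-injective u) , ∈-tabulate⁺ , sym (length-tabulate f)
    where
    pres : ∀ i j → adj G (f i) (f j) ≡ adj (shape s) i j
    pres i j with i Fin.≟ j
    ... | yes refl = trans (adj-irrefl G (f i)) (sym (adj-irrefl (shape s) i))
    ... | no i≢j = not-injective (trans (sym (co-≢ G (i≢j ∘ tabulate-injective u)))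
      (trans (c i j) (co-≢ (shape s) i≢j)))

  spans-K : ∀ {U} → Unique U → NoEdges U U → Spans (K (length U)) U
  spans-K {U} u ne = lookup U , (pres , λ i j → inj u i j) , (λ i → ∈-lookup i) , refl
    where
    inj : ∀ {U} → Unique U → ∀ i j → lookup U i ≡ lookup U j → i ≡ j
    inj (_ ∷ _) zero zero e = refl
    inj (p ∷ _) zero (suc j) e = ⊥-elim (All.lookup p (∈-lookup j) e)
    inj (p ∷ _) (suc i) zero e = ⊥-elim (All.lookup p (∈-lookup i) (sym e))
    inj (_ ∷ u) (suc i) (suc j) e = cong suc (inj u i j e)
    pres : ∀ i j → adj G (lookup U i) (lookup U j) ≡ not (does (i Fin.≟ j))
    pres i j with i Fin.≟ j
    ... | yes refl = adj-irrefl G _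
    ... | no i≢j = co-false (i≢j ∘ inj u i j) (ne (∈-lookup i) (∈-lookup j))

  -- What the pieces other than points can form for each total gap. Only gaps up to 3 matter, so
  -- larger ones carry no information.
  Core : ℕ → List (Fin n) → Set
  Core 0 C = C ≡ []
  Core 1 C = Spans C5 C
  Core 2 C = Spans (C5 ⊕ C5) C
  Core 3 C = Spans Q C ⊎ Spans (C5 ⊕ C5 ⊕ C5) C
  Core _ C = ⊤

  core-⊕ : ∀ g {U C} → NoEdges U C → (∀ {x} → x ∈ U → x ∉ C) → Spans C5 U → Core g C → Core (suc g) (U ++ C)
  core-⊕ 0 {U} n d s refl = subst (Spans C5) (sym (++-identityʳ U)) s
  core-⊕ 1 n d s c = spans-⊕ n d s c
  core-⊕ 2 n d s c = inj₂ (spans-⊕ n d s c)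
  core-⊕ (suc (suc (suc _))) n d s c = tt

  -- Collects the points in `P`. Being isolated in the complement, they give the complete graph of
  -- the join.
  decomp-core : ∀ {g W} → Decomp g W → Unique W →
                ∃₂ λ P C → W ↭ P ++ C × NoEdges P P × NoEdges P C × Core g C
  decomp-core nil u = [] , [] , ↭-refl , (λ ()) , (λ ()) , refl
  decomp-core (cons {U = U} point f c D n σ refl) u
    with decomp-core D (AllPairs-++⁻ʳ (tabulate f) (Unique-resp-↭ σ u))
  ... | P , C , τ , PP , PC , core =
    f zero ∷ P , C , ↭-trans σ (prep (f zero) τ) ,
    (λ { (here refl) (here refl) → co-irrefl _
       ; (here refl) (there j) → toP j
       ; (there i) (here refl) → flip-edge (toP i)
       ; (there i) (there j) → PP i j }) ,
    (λ { (here refl) j → n (here refl) (⊆-↭ (↭-sym τ) (∈-++⁺ʳ P j)) ; (there i) j → PC i j }) ,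
    core
    where
    toP : ∀ {y} → y ∈ P → co G (f zero) y ≡ false
    toP j = n (here refl) (⊆-↭ (↭-sym τ) (∈-++⁺ˡ j))
  decomp-core (cons {g = g} {U = U} pentagon f c D n σ refl) u
    with u′ ← Unique-resp-↭ σ u
    with decomp-core D (AllPairs-++⁻ʳ (tabulate f) u′)
  ... | P , C , τ , PP , PC , core =
    P , tabulate f ++ C , ↭-trans σ (↭-trans (++⁺ˡ (tabulate f) τ) (shifts (tabulate f) P)) ,
    (λ i j → PP i j) ,
    (λ i j → [ (λ k → flip-edge (n k (⊆-↭ (↭-sym τ) (∈-++⁺ˡ i)))) , PC i ]′ (∈-++⁻ (tabulate f) j)) ,
    core-⊕ g (λ i j → n i (C⊆U j)) (λ i j → Unique-++-disjoint (tabulate f) u′ i (C⊆U j))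
      (spans-copy pentagon c (AllPairs-++⁻ˡ (tabulate f) u′)) core
    where
    C⊆U : C ⊆ U
    C⊆U j = ⊆-↭ (↭-sym τ) (∈-++⁺ʳ P j)
  decomp-core (cons {g = g} {U = U} thirteen f c D n σ refl) u
    with u′ ← Unique-resp-↭ σ u
    with decomp-core D (AllPairs-++⁻ʳ (tabulate f) u′)
  ... | P , C , τ , PP , PC , core =
    P , tabulate f ++ C , ↭-trans σ (↭-trans (++⁺ˡ (tabulate f) τ) (shifts (tabulate f) P)) ,
    (λ i j → PP i j) ,
    (λ i j → [ (λ k → flip-edge (n k (⊆-↭ (↭-sym τ) (∈-++⁺ˡ i)))) , PC i ]′ (∈-++⁻ (tabulate f) j)) ,
    thirteen-core g core
    where
    thirteen-core : ∀ g → Core g C → Core (3 + g) (tabulate f ++ C)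
    thirteen-core zero refl = inj₁
        (subst (Spans Q) (sym (++-identityʳ (tabulate f)))
        (spans-copy thirteen c (AllPairs-++⁻ˡ (tabulate f) u′)))
    thirteen-core (suc g) _ = tt

  embedding⇒≅ : ∀ {m} {H : Graph m} → m ≡ n → (∃ λ f → IsEmbedding H f) → G ≅ H
  embedding⇒≅ {m} {H} e (f , pres , inj) = record
    { bij = mk↔ₛ′ inverse f (λ i → inj _ _ (right (f i))) right
    ; preserve = λ i j → trans (sym (pres (inverse i) (inverse j))) (cong₂ (adj G) (right i) (right j)) }
    where
    preimage : ∀ x → ∃ λ i → x ≡ f i
    preimage x = ∈-tabulate⁻ (∈-resp-↭ (⊆⇒↭ (AllPairs.tabulate⁺ λ i≢j → i≢j ∘ inj _ _) (λ {y} _ → ∈-allFin y)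
      (trans (length-tabulate f) (trans e (sym (length-tabulate {n = n} id))))) (∈-allFin x))
    inverse : Fin n → Fin m
    inverse x = proj₁ (preimage x)
    right : ∀ x → f (inverse x) ≡ x
    right x = sym (proj₂ (preimage x))

  anyVec? : ∀ {k} m {P : Vec.Vec (Fin k) m → Set} → (∀ xs → Dec (P xs)) → Dec (∃ P)
  anyVec? zero P? = map′ (λ p → Vec.[] , p) (λ { (Vec.[] , p) → p }) (P? Vec.[])
  anyVec? (suc m) P? = map′ (λ (x , xs , p) → x Vec.∷ xs , p) (λ { (x Vec.∷ xs , p) → x , xs , p })
    (Fin.any? λ x → anyVec? m λ xs → P? (x Vec.∷ xs))

  -- Makes the conclusion decidable by trying all maps, listed as vectors.
  embedding? : ∀ {m} (H : Graph m) → Dec (∃ λ f → IsEmbedding H f)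
  embedding? {m} H = map′ (λ (xs , e) → Vec.lookup xs , e)
    (λ (f , p , j) → Vec.tabulate f ,
      (λ x y → trans (cong₂ (adj G) (Vec.lookup∘tabulate f x) (Vec.lookup∘tabulate f y)) (p x y)) ,
      (λ x y e → j x y (trans (sym (Vec.lookup∘tabulate f x)) (trans e (Vec.lookup∘tabulate f y)))))
    (anyVec? m λ xs →
      (Fin.all? λ i → Fin.all? λ j → adj G (Vec.lookup xs i) (Vec.lookup xs j) Bool.≟ adj H i j) ×-dec
      (Fin.all? λ i → Fin.all? λ j → (Vec.lookup xs i Fin.≟ Vec.lookup xs j) →-dec (i Fin.≟ j)))

  -- The theorem for a given graph

  module _ {χ ω : ℕ} (isχ : IsChromaticNumber G χ) (isω : IsCliqueNumber G ω) (ω+3≤χ : ω + 3 ≤ χ) (n≡χ+6 : n ≡ χ + 6) where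

    χ≤ : ∀ {k} → Cov (allFin n) k → χ ≤ k
    χ≤ {k} c = ≮⇒≥ λ k<χ → proj₂ isχ k k<χ (cov⇒colourable c)

    gap-3 : Gap 3 (allFin n)
    gap-3 c i = let (S , cl , e) = ind⇒clique i in
      ≤-trans (+-monoˡ-≤ 3 (≤-trans (≤-reflexive (sym e)) (proj₂ isω S cl))) (≤-trans ω+3≤χ (χ≤ c))

    -- A better cover would colour `G` with fewer than n - 6 = χ colours.
    not-better : ¬ Better 3 (allFin n)
    not-better (k , c , l) = 1+n≰n
        (≤-trans l (≤-trans (≤-reflexive (trans (length-tabulate {n = n} id) n≡χ+6)) (+-monoˡ-≤ 6 (χ≤ c))))

    Conclusion : Set
    Conclusion = (7 ≤ χ × ∃ λ f → IsEmbedding (K (χ ∸ 7) ⊕ Q) f) ⊎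
        (9 ≤ χ × ∃ λ f → IsEmbedding (K (χ ∸ 9) ⊕ C5 ⊕ C5 ⊕ C5) f)

    subtract : ∀ {a} c → a + (c + 6) ≡ n → c ≤ χ × a ≡ χ ∸ c
    subtract {a} c e = subst (c ≤_) a+c≡χ (m≤n+m c a) , trans (sym (m+n∸n≡m a c)) (cong (_∸ c) a+c≡χ)
      where
      a+c≡χ : a + c ≡ χ
      a+c≡χ = +-cancelʳ-≡ 6 (a + c) χ (trans (+-assoc a c 6) (trans e n≡χ+6))

    conclude : Decomp 3 (allFin n) → Conclusion
    conclude D with uniq ← Uniqueₚ.allFin⁺ n with decomp-core D uniq
    ... | P , C , σ , PP , PC , core = finish core
      where
      u = Unique-resp-↭ σ uniq
      join : ∀ {m} {H : Graph m} → Spans H C → Spans (K (length P) ⊕ H) (P ++ C)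
      join = spans-⊕ PC (Unique-++-disjoint P u) (spans-K (AllPairs-++⁻ˡ P u) PP)
      order : length (P ++ C) ≡ n
      order = trans (sym (↭-length σ)) (length-tabulate {n = n} id)
      finish : Core 3 C → Conclusion
      finish (inj₁ s) = let (f , e , _ , l) = join s ; (c≤χ , a≡) = subtract 7 (trans l order) in
        inj₁ (c≤χ , subst (λ a → ∃ λ f → IsEmbedding (K a ⊕ Q) f) a≡ (f , e))
      finish (inj₂ s) = let (f , e , _ , l) = join s ; (c≤χ , a≡) = subtract 9 (trans l order) in
        inj₂ (c≤χ , subst (λ a → ∃ λ f → IsEmbedding (K a ⊕ C5 ⊕ C5 ⊕ C5) f) a≡ (f , e))

    conclusion : Conclusion
    conclusion = decidable-stable
      (((7 ≤? χ) ×-dec embedding? (K (χ ∸ 7) ⊕ Q)) ⊎-dec ((9 ≤? χ) ×-dec embedding? (K (χ ∸ 9) ⊕ C5 ⊕ C5 ⊕ C5)))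
      (¬¬-map [ (λ b → ⊥-elim (not-better b)) , conclude ]′
        (outcome (length (allFin n)) ≤-refl (Uniqueₚ.allFin⁺ n) ≤-refl gap-3))

    order-eq : ∀ c → c ≤ χ → (χ ∸ c) + (c + 6) ≡ n
    order-eq c c≤χ = trans (sym (+-assoc (χ ∸ c) c 6)) (trans (cong (_+ 6) (m∸n+n≡m c≤χ)) (sym n≡χ+6))

theorem1p4 : ∀ {n} (G : Graph n) (χ ω : ℕ) →
    IsChromaticNumber G χ → IsCliqueNumber G ω →
    ω + 3 ≤ χ → n ≡ χ + 6 →
    (7 ≤ χ × G ≅ (K (χ ∸ 7) ⊕ Q)) ⊎ (9 ≤ χ × G ≅ (K (χ ∸ 9) ⊕ C5 ⊕ C5 ⊕ C5))
theorem1p4 G χ ω isχ isω gap order =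
  [ (λ (c≤χ , e) → inj₁ (c≤χ , embedding⇒≅ G (order-eq G isχ isω gap order 7 c≤χ) e))
  , (λ (c≤χ , e) → inj₂ (c≤χ , embedding⇒≅ G (order-eq G isχ isω gap order 9 c≤χ) e)) ]′
  (conclusion G isχ isω gap order)
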